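{- Let $L$ be a relational language as in the context. Let $\mathcal{M}$ be the generic structure of the amalgamation class $(\mathcal{C}_0(L),\leq)$ and $\hat{\mathcal{M}}$ the generic structure of the amalgamation class $(\hat{\mathcal{C}}_0(L),\leq)$. Then the geometries $G(\mathcal{M})$ and $G(\hat{\mathcal{M}})$ are isomorphic.
   Context: $L$ consists of relation symbols $(R_i:i\in I)$, $I\neq\emptyset$, $R_i$ of arity $n_i\geq 3$, with only finitely many symbols of each arity. $\mathcal{C}_0(L)$ is the class of finite $L$-structures $A$ in which each $R_i^A$ is a set of $n_i$-element subsets of $A$ (symmetric relations) and $\delta(A')\geq0$ for all $A'\subseteq A$, where $\delta(A)=|A|-\sum_i|R_i^A|$ and substructures are induced. $\hat{\mathcal{C}}_0(L)$ is the class of finite $L$-structures $A$ in which each $R_i^A$ is an arbitrary set of $n_i$-tuples of (not necessarily distinct) elements of $A$, with the predimension again $\delta(A)=|A|-\sum_i|R_i^A|$, and $\delta(A')\geq0$ for all $A'\subseteq A$. In either class, for $A\subseteq B$, $A\leq B$ means $\delta(A)\leq\delta(B')$ for all $A\subseteq B'\subseteq B$; for infinite structures all of whose finite substructures are in the class, $A\leq B$ means $\delta(C)\geq\delta(C\cap A)$ for all finite $C\subseteq B$. For finite $A\subseteq B$, $d_B(A)=\min\{\delta(A'):A\subseteq A'\subseteq B\text{ finite}\}$, ${\rm cl}_B(A)=\{c:d_B(A\cup\{c\})=d_B(A)\}$ (extended to infinite sets by unions over finite subsets); $(B,{\rm cl}_B)$ is a pregeometry with associated geometry $G(B)$ (points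 ${\rm cl}_B(x)\setminus{\rm cl}_B(\emptyset)$ for $x\notin{\rm cl}_B(\emptyset)$, induced closure). Both $(\mathcal{C}_0(L),\leq)$ and $(\hat{\mathcal{C}}_0(L),\leq)$ are amalgamation classes (closed under self-sufficient substructures, and any $A\leq B_1,B_2$ can be amalgamated into some $C$ in the class via embeddings with self-sufficient images agreeing on $A$). The generic structure of such a class is the unique-up-to-isomorphism countable structure, all of whose finite substructures are in the class, which is the union of a chain $A_0\leq A_1\leq\cdots$ of members of the class and such that for every finite $A\leq\mathcal{M}$ and $A\leq B$ in the class there is an embedding of $B$ into $\mathcal{M}$ over $A$ with self-sufficient image. -}

module Defs where

open import Data.Nat using (ℕ; zero; suc; _+_; _≤_)
open import Data.Fin using (Fin)
open import Data.Empty using (⊥)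
open import Data.Product using (Σ; _×_; _,_; proj₁)
open import Data.Sum using (_⊎_)
open import Data.List using (List; []; _∷_; [_]; length; allFin)
open import Data.List.Membership.Propositional using (_∈_)
open import Data.List.Relation.Unary.Any using (Any)
open import Data.List.Relation.Unary.AllPairs using (AllPairs)
open import Data.List.Relation.Unary.Unique.Propositional using (Unique)
open import Data.Vec using (Vec; lookup; map; toList; tabulate)
open import Data.Vec.Membership.Propositional renaming (_∈_ to _∈ᵥ_)
open import Relation.Nullary using (¬_)
open import Relation.Binary.PropositionalEquality using (_≡_)

_⟺_ : Set → Set → Set
A ⟺ B = (A → B) × (B → A)
infix 3 _⟺_

record Lang : Set₁ where
  field
    I : Set
    ar : I → ℕ
    ar≥3 : ∀ i → 3 ≤ ar i
    nonempty : I
    finitePerArity : ∀ n → Σ (List I) λ is → ∀ i → ar i ≡ n → i ∈ is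

-- sym : the class C₀(L) (relations are sets of n_i-element subsets)
-- gen : the class Ĉ₀(L) (relations are arbitrary sets of n_i-tuples)
data Mode : Set where
  sym gen : Mode

module _ (L : Lang) where
  open Lang L

  record Str (X : Set) : Set₁ where
    field
      R : (i : I) → Vec X (ar i) → Set
  open Str public

  InjTuple : ∀ {X : Set} {n} → Vec X n → Set
  InjTuple t = ∀ p q → lookup t p ≡ lookup t q → p ≡ q

  _⊆ₗ_ : ∀ {X : Set} → List X → List X → Set
  A ⊆ₗ B = ∀ x → x ∈ A → x ∈ B

  module _ (μ : Mode) {X : Set} (S : Str X) where

    record Fact (A : List X) : Set where
      constructor fact
      field
        rel : I
        tup : Vec X (ar rel)
        holds : R S rel tup
        inA : ∀ x → x ∈ᵥ tup → x ∈ A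
    open Fact

    -- when two instances count as the same element of some R_i^A
    SameFact' : Mode → ∀ {A} → Fact A → Fact A → Set
    SameFact' gen f g =
      _≡_ {A = Σ I (λ i → Vec X (ar i))} (rel f , tup f) (rel g , tup g)
    SameFact' sym f g = (rel f ≡ rel g) × (∀ x → x ∈ᵥ tup f ⟺ x ∈ᵥ tup g)

    SameFact : ∀ {A} → Fact A → Fact A → Set
    SameFact = SameFact' μ

    -- Σ_i |R_i^A| = m  (A a duplicate-free list)
    FactCount : List X → ℕ → Set
    FactCount A m = Σ (List (Fact A)) λ fs →
      AllPairs (λ f g → ¬ SameFact f g) fs ×
      (∀ f → Any (SameFact f) fs) ×
      length fs ≡ m

    -- δ(A) ≥ 0 (in particular Σ_i |R_i^A| is finite)
    δ≥0 : List X → Set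
    δ≥0 A = Σ ℕ λ m → FactCount A m × m ≤ length A

    δ≤δ : List X → List X → Set
    δ≤δ A B = ∀ m n → FactCount A m → FactCount B n → length A + n ≤ length B + m

    δ≡ : List X → ℕ → Set
    δ≡ A k = Σ ℕ λ m → FactCount A m × length A ≡ k + m

    δ≥ : List X → ℕ → Set
    δ≥ A k = ∀ m → FactCount A m → k + m ≤ length A

    InClass : Set
    InClass = InClass' μ
      where
      InClass' : Mode → Set
      InClass' gen = ∀ A → Unique A → δ≥0 A
      InClass' sym =
        (∀ i t → R S i t → InjTuple t) ×
        (∀ i t u → (∀ x → x ∈ᵥ t ⟺ x ∈ᵥ u) → R S i t → R S i u) ×
        (∀ A → Unique A → δ≥0 A)

    SSfin : List X → List X → Set
    SSfin A B = ∀ B' → Unique B' → A ⊆ₗ B' → B' ⊆ₗ B → δ≤δ A B'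

    SSinf : List X → Set
    SSinf A = ∀ C → Unique C → ∀ D → Unique D →
      (∀ x → x ∈ D ⟺ (x ∈ C × x ∈ A)) → δ≤δ D C

    DIs : (X → Set) → ℕ → Set
    DIs P k =
      (Σ (List X) λ A' → Unique A' × (∀ x → P x → x ∈ A') × δ≡ A' k) ×
      (∀ A' → Unique A' → (∀ x → P x → x ∈ A') → δ≥ A' k)

    clFin : List X → X → Set
    clFin A c = Σ ℕ λ k → DIs (λ x → x ∈ A) k × DIs (λ x → x ∈ A ⊎ x ≡ c) k

    cl : (X → Set) → X → Set
    cl P c = Σ (List X) λ A → (∀ x → x ∈ A → P x) × clFin A c

    -- points of the geometry G(S), via representatives x ∉ cl(∅)
    Point : Set
    Point = Σ X λ x → ¬ clFin [] x

    ptSet : Point → X → Set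
    ptSet p z = clFin [ proj₁ p ] z × ¬ clFin [] z

    PtEq : Point → Point → Set
    PtEq p q = ∀ z → ptSet p z ⟺ ptSet q z

    clG : (Point → Set) → Point → Set
    clG Q p = ∀ z → ptSet p z →
      cl (λ w → Σ Point λ q → Q q × ptSet q w) z

  GeomIso : (μ₁ : Mode) {X : Set} (S₁ : Str X) (μ₂ : Mode) {Y : Set} (S₂ : Str Y) → Set₁
  GeomIso μ₁ S₁ μ₂ S₂ =
    Σ (Point μ₁ S₁ → Point μ₂ S₂) λ f →
    Σ (Point μ₂ S₂ → Point μ₁ S₁) λ g →
    (∀ p p' → PtEq μ₁ S₁ p p' → PtEq μ₂ S₂ (f p) (f p')) ×
    (∀ q q' → PtEq μ₂ S₂ q q' → PtEq μ₁ S₁ (g q) (g q')) ×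
    (∀ p → PtEq μ₁ S₁ (g (f p)) p) ×
    (∀ q → PtEq μ₂ S₂ (f (g q)) q) ×
    (∀ (Q : Point μ₁ S₁ → Set) p →
       clG μ₁ S₁ Q p ⟺
       clG μ₂ S₂ (λ q → Σ (Point μ₁ S₁) λ p' → Q p' × PtEq μ₂ S₂ (f p') q) (f p))

  IsEmbedding : ∀ {X Y : Set} → Str X → Str Y → (X → Y) → Set
  IsEmbedding B S g =
    (∀ x y → g x ≡ g y → x ≡ y) ×
    (∀ i t → R B i t ⟺ R S i (map g t))

  IsGeneric : (μ : Mode) {X : Set} → Str X → Set₁
  IsGeneric μ {X} S =
    InClass μ S ×
    (Σ (ℕ → List X) λ A →
       (∀ k → Unique (A k)) ×
       (∀ k → A k ⊆ₗ A (suc k)) ×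
       (∀ k → SSfin μ S (A k) (A (suc k))) ×
       (∀ x → Σ ℕ λ k → x ∈ A k)) ×
    -- extension property: A ≤ S finite (listed injectively by a),
    -- A ≤ B in the class (A sits in B via ι), then B embeds over A
    -- into S with self-sufficient image
    (∀ k (a : Vec X k) → InjTuple a → SSinf μ S (toList a) →
     ∀ n (B : Str (Fin n)) → InClass μ B →
     ∀ (ι : Fin k → Fin n) → (∀ p q → ι p ≡ ι q → p ≡ q) →
     (∀ i (t : Vec (Fin k) (ar i)) → R S i (map (lookup a) t) ⟺ R B i (map ι t)) →
     SSfin μ B (toList (tabulate ι)) (allFin n) →
     Σ (Fin n → X) λ g →
       IsEmbedding B S g ×
       (∀ p → g (ι p) ≡ lookup a p) ×
       SSinf μ S (toList (tabulate g)))

{-# OPTIONS --safe #-}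
module Submission where

-- Two predimensions on the same finite set define the same dimension function as soon as every
-- set C has a superset D with δ′(D) ≤ δ(C), and conversely. A back-and-forth argument builds a
-- bijection between the two generic structures out of finite bijections between self-sufficient
-- sets that preserve the dimension function in this sense; the limit is an isomorphism of
-- pregeometries, hence of geometries.
--
-- When A ≤ B, the dimension function of B depends on the facts inside A only through the dimension
-- function of A. So, going forth from C₀(L), the facts of B not contained in A can be copied
-- verbatim to Ĉ₀(L). Going back, a tuple may have repeated entries, and several facts may live on
-- the same set. Therefore, on both sides, every position of every new fact receives a new point
-- parallel to its entry, by means of a gadget of rank 1: r + 2 points and the r + 1 sets omitting
-- two consecutive ones, where r ≥ 3 is the arity of some symbol. In C₀(L) the fact is then put on
-- the new points, which are pairwise distinct and belong to this fact only.

-- Closed sets make the replacement of facts by copies invisible to the dimension. A nonempty part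
-- of a gadget has predimension at least 1 and the whole gadget exactly 1, so a gadget that is met
-- can be filled at no cost. Every set can thus be enlarged, without raising its predimension, until
-- each gadget lies inside it or is disjoint from it. On such a set a point and its parallel copy
-- occur together, so a fact and its copy are counted alike. A second obstacle is that the relations
-- are arbitrary predicates and the points have no decidable equality. Facts are therefore handled
-- through the finite lists that `δ≥0` provides, and finite sets of points through Boolean functions
-- on the indices of an enumeration. Minima over supersets are never computed: domination in both
-- directions stands for the equality of dimensions, and it passes to the limit because every finite
-- set lies in some stage.

open import Defs
open import Data.Bool using (Bool; true; false; _∧_; _∨_; not; if_then_else_)
import Data.Bool.Properties as Bool
open import Data.Empty using (⊥-elim)
open import Data.Fin as F using (Fin; zero; suc; toℕ; _↑ˡ_; _↑ʳ_; combine; inject₁; punchIn; punchOut)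
import Data.Fin.Properties as Fin
open import Data.List as List using (List; []; _∷_; length)
open import Data.List.Membership.DecPropositional using (_∈?_)
open import Data.List.Membership.Propositional using (_∈_)
import Data.List.Membership.Propositional.Properties as ∈P
import Data.List.Properties as List
open import Data.List.Relation.Unary.All as All using (All; []; _∷_)
import Data.List.Relation.Unary.All.Properties as AllP
open import Data.List.Relation.Unary.AllPairs as AllPairs using (AllPairs; []; _∷_)
import Data.List.Relation.Unary.AllPairs.Properties as AllPairsP
open import Data.List.Relation.Unary.Any as Any using (Any; here; there)
import Data.List.Relation.Unary.Any.Properties as AnyP
open import Data.List.Relation.Unary.Unique.Propositional using (Unique)
open import Data.Nat using (ℕ; zero; suc; _+_; _*_; _∸_; _⊔_; _≤_; _<_; _<?_; z≤n; s≤s; s≤s⁻¹; _≤′_; ≤′-refl; ≤′-step)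
open import Data.Nat.Properties
open import Data.Nat.Tactic.RingSolver using (solve-∀)
open import Data.Product using (Σ; ∃; _×_; _,_; proj₁; proj₂)
open import Data.Sum using (_⊎_; inj₁; inj₂)
open import Data.Unit using (⊤; tt)
open import Data.Vec as Vec using (Vec; []; _∷_; map; lookup; tabulate; toList)
open import Data.Vec.Membership.Propositional using () renaming (_∈_ to _∈ᵥ_)
import Data.Vec.Membership.Propositional.Properties as ∈V
import Data.Vec.Properties as Vec
import Data.Vec.Relation.Unary.Any as VecAny
import Data.Vec.Relation.Unary.Any.Properties as VecAnyP
open import Function using (_∘_; id)
open import Relation.Binary.Definitions using (tri<; tri≈; tri>)
open import Relation.Binary.PropositionalEquality hiding (sym)
open import Relation.Binary.PropositionalEquality using () renaming (sym to ≡-sym)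
open import Relation.Nullary using (¬_; Dec; does; yes; no; contradiction)
open import Relation.Nullary.Decidable using (¬?; _⊎-dec_)
open import Algebra.Properties.CommutativeMonoid.Sum +-0-commutativeMonoid using (sum; ∑-distrib-+; sum-cong-≗)

-- Finite sums and subsets of Fin n

-- Reduces a linear goal to a ring identity, with the sum of the hypotheses for a ≤ b.
≤-by : ∀ {A B a b} → a ≤ b → A + b ≤ B + a → A ≤ B
≤-by {A} {B} {a} {b} a≤b q = +-cancelʳ-≤ b A B (≤-trans q (+-monoʳ-≤ B a≤b))

sum-mono : ∀ {n} {f g : Fin n → ℕ} → (∀ i → f i ≤ g i) → sum f ≤ sum g
sum-mono {zero} h = z≤n
sum-mono {suc n} h = +-mono-≤ (h zero) (sum-mono (h ∘ suc))

sum-gain : ∀ {n} {f g : Fin n → ℕ} x i → (∀ i → f i ≤ g i) → x + f i ≤ g i → x + sum f ≤ sum g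
sum-gain {suc n} {f} {g} x zero h e = begin
  x + (f zero + sum (f ∘ suc)) ≡⟨ +-assoc x _ _ ⟨
  x + f zero + sum (f ∘ suc)   ≤⟨ +-mono-≤ e (sum-mono (h ∘ suc)) ⟩
  g zero + sum (g ∘ suc)       ∎
  where open ≤-Reasoning
sum-gain {suc n} {f} {g} x (suc i) h e = begin
  x + (f zero + sum (f ∘ suc)) ≡⟨ rearrange x (f zero) (sum (f ∘ suc)) ⟩
  f zero + (x + sum (f ∘ suc)) ≤⟨ +-mono-≤ (h zero) (sum-gain x i (h ∘ suc) e) ⟩
  g zero + sum (g ∘ suc)       ∎
  where
  open ≤-Reasoning
  rearrange : ∀ x y z → x + (y + z) ≡ y + (x + z)
  rearrange = solve-∀

term≤sum : ∀ {n} (f : Fin n → ℕ) i → f i ≤ sum f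
term≤sum {suc n} f zero = m≤m+n _ _
term≤sum {suc n} f (suc i) = ≤-trans (term≤sum (f ∘ suc) i) (m≤n+m _ _)

sum-const : ∀ n c → sum {n} (λ _ → c) ≡ n * c
sum-const zero c = refl
sum-const (suc n) c = cong (c +_) (sum-const n c)

sum-↑ : ∀ m {n} (f : Fin (m + n) → ℕ) → sum f ≡ sum (λ i → f (i ↑ˡ n)) + sum (λ j → f (m ↑ʳ j))
sum-↑ zero f = refl
sum-↑ (suc m) f = trans (cong (f zero +_) (sum-↑ m (f ∘ suc))) (≡-sym (+-assoc (f zero) _ _))

sum-combine : ∀ m n (f : Fin (m * n) → ℕ) → sum f ≡ sum {m} (λ i → sum {n} (λ j → f (combine i j)))
sum-combine zero n f = refl
sum-combine (suc m) n f = trans (sum-↑ n f) (cong (sum (λ j → f (j ↑ˡ (m * n))) +_) (sum-combine m n (λ j → f (n ↑ʳ j))))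

𝟙 : Bool → ℕ
𝟙 true = 1
𝟙 false = 0

𝟙-mono : ∀ {b c} → (b ≡ true → c ≡ true) → 𝟙 b ≤ 𝟙 c
𝟙-mono {false} h = z≤n
𝟙-mono {true} h rewrite h refl = ≤-refl

𝟙≤1 : ∀ b → 𝟙 b ≤ 1
𝟙≤1 b = 𝟙-mono {b} {true} (λ _ → refl)

Sub : ℕ → Set
Sub n = Fin n → Bool

infix 4 _⊑_
_⊑_ : ∀ {n} → Sub n → Sub n → Set
C ⊑ D = ∀ v → C v ≡ true → D v ≡ true

size : ∀ {n} → Sub n → ℕ
size C = sum (𝟙 ∘ C)

size-mono : ∀ {n} {C D : Sub n} → C ⊑ D → size C ≤ size D
size-mono h = sum-mono (λ v → 𝟙-mono (h v))

size≤n : ∀ {n} (C : Sub n) → size C ≤ n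
size≤n {n} C = ≤-trans (sum-mono (𝟙≤1 ∘ C)) (≤-reflexive (trans (sum-const n 1) (*-identityʳ n)))

size-full : ∀ {n} {C : Sub n} → (∀ v → C v ≡ true) → size C ≡ n
size-full {n} {C} h = trans (sum-cong-≗ (λ v → cong 𝟙 (h v))) (trans (sum-const n 1) (*-identityʳ n))

size-∁ : ∀ {n} (C : Sub n) → sum (𝟙 ∘ not ∘ C) + size C ≡ n
size-∁ {n} C = begin
  sum (𝟙 ∘ not ∘ C) + size C        ≡⟨ ∑-distrib-+ (𝟙 ∘ not ∘ C) (𝟙 ∘ C) ⟨
  sum (λ v → 𝟙 (not (C v)) + 𝟙 (C v)) ≡⟨ sum-cong-≗ (λ v → one (C v)) ⟩
  sum {n} (λ _ → 1)                 ≡⟨ sum-const n 1 ⟩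
  n * 1                             ≡⟨ *-identityʳ n ⟩
  n                                 ∎
  where
  open ≡-Reasoning
  one : ∀ b → 𝟙 (not b) + 𝟙 b ≡ 1
  one true = refl
  one false = refl

∨-⊑ˡ : ∀ {b c} → b ≡ true → b ∨ c ≡ true
∨-⊑ˡ refl = refl

adjoin : ∀ {n} → Bool → Fin n → Sub n → Sub n
adjoin d w C v = C v ∨ (d ∧ does (w Fin.≟ v))

size-adjoin : ∀ {n} d (w : Fin n) C → size (adjoin d w C) ≤ size C + 𝟙 (d ∧ not (C w))
size-adjoin {suc n} d zero C = begin
  𝟙 (C zero ∨ (d ∧ true)) + size (λ v → C (suc v) ∨ (d ∧ false))
    ≤⟨ +-mono-≤ (head (C zero) d) (size-mono (λ v → tail (C (suc v)) d)) ⟩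
  𝟙 (C zero) + 𝟙 (d ∧ not (C zero)) + size (C ∘ suc)
    ≡⟨ rearrange (𝟙 (C zero)) _ _ ⟩
  𝟙 (C zero) + size (C ∘ suc) + 𝟙 (d ∧ not (C zero)) ∎
  where
  open ≤-Reasoning
  rearrange : ∀ x y z → x + y + z ≡ x + z + y
  rearrange = solve-∀
  head : ∀ c d → 𝟙 (c ∨ (d ∧ true)) ≤ 𝟙 c + 𝟙 (d ∧ not c)
  head true d = s≤s z≤n
  head false true = s≤s z≤n
  head false false = z≤n
  tail : ∀ c d → c ∨ (d ∧ false) ≡ true → c ≡ true
  tail true d _ = refl
  tail false true ()
  tail false false ()
size-adjoin {suc n} d (suc w) C = begin
  𝟙 (C zero ∨ (d ∧ false)) + size (adjoin d w (C ∘ suc))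
    ≤⟨ +-mono-≤ (head (C zero) d) (size-adjoin d w (C ∘ suc)) ⟩
  𝟙 (C zero) + (size (C ∘ suc) + 𝟙 (d ∧ not (C (suc w))))
    ≡⟨ +-assoc (𝟙 (C zero)) _ _ ⟨
  𝟙 (C zero) + size (C ∘ suc) + 𝟙 (d ∧ not (C (suc w))) ∎
  where
  open ≤-Reasoning
  head : ∀ c d → 𝟙 (c ∨ (d ∧ false)) ≤ 𝟙 c
  head true d = s≤s z≤n
  head false true = z≤n
  head false false = z≤n

adjoinAll : ∀ {k n} → (Fin k → Fin n) → Sub k → Sub n → Sub n
adjoinAll {zero} φ D C = C
adjoinAll {suc k} φ D C = adjoinAll (φ ∘ suc) (D ∘ suc) (adjoin (D zero) (φ zero) C)

adjoinAll-⊒ : ∀ {k n} (φ : Fin k → Fin n) D C → C ⊑ adjoinAll φ D C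
adjoinAll-⊒ {zero} φ D C v h = h
adjoinAll-⊒ {suc k} φ D C v h = adjoinAll-⊒ (φ ∘ suc) (D ∘ suc) _ v (∨-⊑ˡ h)

adjoinAll-∋ : ∀ {k n} (φ : Fin k → Fin n) D C p → D p ≡ true → adjoinAll φ D C (φ p) ≡ true
adjoinAll-∋ {suc k} φ D C zero h = adjoinAll-⊒ (φ ∘ suc) (D ∘ suc) _ (φ zero) new
  where
  new : C (φ zero) ∨ (D zero ∧ does (φ zero Fin.≟ φ zero)) ≡ true
  new rewrite h with φ zero Fin.≟ φ zero
  ... | no ¬p = contradiction refl ¬p
  ... | yes _ with C (φ zero)
  ...   | true = refl
  ...   | false = refl
adjoinAll-∋ {suc k} φ D C (suc p) h = adjoinAll-∋ (φ ∘ suc) (D ∘ suc) _ p h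

-- Only an upper bound: `φ` is arbitrary, and a point reached from several indices is charged once
-- for each of them.
size-adjoinAll : ∀ {k n} (φ : Fin k → Fin n) D C →
  size (adjoinAll φ D C) ≤ size C + sum (λ p → 𝟙 (D p ∧ not (C (φ p))))
size-adjoinAll {zero} φ D C = ≤-reflexive (≡-sym (+-identityʳ _))
size-adjoinAll {suc k} φ D C = begin
  size (adjoinAll (φ ∘ suc) (D ∘ suc) C₁)
    ≤⟨ size-adjoinAll (φ ∘ suc) (D ∘ suc) C₁ ⟩
  size C₁ + sum (λ p → 𝟙 (D (suc p) ∧ not (C₁ (φ (suc p)))))
    ≤⟨ +-mono-≤ (size-adjoin (D zero) (φ zero) C) (sum-mono (λ p → 𝟙-mono (anti (D (suc p)) (C (φ (suc p))) _))) ⟩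
  size C + 𝟙 (D zero ∧ not (C (φ zero))) + sum (λ p → 𝟙 (D (suc p) ∧ not (C (φ (suc p)))))
    ≡⟨ +-assoc (size C) _ _ ⟩
  size C + sum (λ p → 𝟙 (D p ∧ not (C (φ p)))) ∎
  where
  open ≤-Reasoning
  C₁ : Sub _
  C₁ = adjoin (D zero) (φ zero) C
  anti : ∀ d c x → d ∧ not (c ∨ x) ≡ true → d ∧ not c ≡ true
  anti true false x _ = refl

-- Writing δ_f C = |C| − f C, Dom f g says that every C has a superset D with δ_g D ≤ δ_f C;
-- Dom f g and Dom g f together say that f and g define the same dimension function d.
Dom : ∀ {n} → (Sub n → ℕ) → (Sub n → ℕ) → Set
Dom f g = ∀ C → Σ (Sub _) λ D → C ⊑ D × size D + f C ≤ size C + g D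

Mono : ∀ {n} → (Sub n → ℕ) → Set
Mono f = ∀ {C D} → C ⊑ D → f C ≤ f D

Dom-trans : ∀ {n} {f g h : Sub n → ℕ} → Dom f g → Dom g h → Dom f h
Dom-trans {f = f} {g} {h} fg gh C with fg C
... | D , C⊑D , p with gh D
... | E , D⊑E , q = E , (λ v → D⊑E v ∘ C⊑D v) ,
  ≤-by (+-mono-≤ p q) (≤-reflexive (ring (size E) (f C) (size C) (g D) (size D) (h E)))
  where
  ring : ∀ e fc c gd d he → e + fc + (c + gd + (d + he)) ≡ c + he + (d + fc + (e + gd))
  ring = solve-∀

Dom-cong : ∀ {n} {f f′ g g′ : Sub n → ℕ} → (∀ C → f C ≡ f′ C) → (∀ C → g C ≡ g′ C) → Dom f g → Dom f′ g′
Dom-cong ff gg d C with d C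
... | D , s , p = D , s , subst₂ (λ x y → size D + x ≤ size C + y) (ff C) (gg D) p

-- From δ_f C ≥ δ_g D ≥ 0. In this way a structure that is about to be realised inherits the class
-- condition from one that already sits in the other generic structure.
Dom-bounded : ∀ {n} {f g : Sub n → ℕ} → Dom f g → (∀ C → g C ≤ size C) → ∀ C → f C ≤ size C
Dom-bounded {f = f} {g} d bound C with d C
... | D , s , p = +-cancelˡ-≤ (size D) (f C) (size C) (begin
  size D + f C    ≤⟨ p ⟩
  size C + g D    ≤⟨ +-monoʳ-≤ (size C) (bound D) ⟩
  size C + size D ≡⟨ +-comm (size C) _ ⟩
  size D + size C ∎)
  where open ≤-Reasoning

-- The dimension function after adding edges depends on the old edges only through the old
-- dimension function: enlarge C ∩ A inside A to a set that is optimal for the other old structure.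
Dom-extend : ∀ {k n} (ι : Fin k → Fin n) {f g : Sub k → ℕ} {h : Sub n → ℕ} →
  Dom f g → Mono g → Mono h → Dom (λ C → f (C ∘ ι) + h C) (λ C → g (C ∘ ι) + h C)
Dom-extend ι {f} {g} {h} fg g-mono h-mono C with fg (C ∘ ι)
... | D , C⊑D , p = C′ , adjoinAll-⊒ ι D C ,
  ≤-by (+-mono-≤ u (+-mono-≤ w (+-mono-≤ p (+-mono-≤ gg hh))))
       (≤-reflexive (ring (size C′) (f (C ∘ ι)) (h C) (size C) s (size D) (size (C ∘ ι)) (g D) (g (C′ ∘ ι)) (h C′)))
  where
  C′ : Sub _
  C′ = adjoinAll ι D C
  s : ℕ
  s = sum (λ p → 𝟙 (D p ∧ not (C (ι p))))
  u : size C′ ≤ size C + s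
  u = size-adjoinAll ι D C
  split : ∀ d c → (c ≡ true → d ≡ true) → 𝟙 (d ∧ not c) + 𝟙 c ≤ 𝟙 d
  split true true _ = s≤s z≤n
  split true false _ = s≤s z≤n
  split false true h = contradiction (h refl) (λ ())
  split false false _ = z≤n
  -- By `C⊑D`, the indices to be adjoined and those already in `C ∘ ι` are disjoint parts of `D`.
  -- The enlargement thus costs at most |D| - |C ∘ ι|, and `p` pays for it.
  w : s + size (C ∘ ι) ≤ size D
  w = ≤-trans (≤-reflexive (≡-sym (∑-distrib-+ (λ p → 𝟙 (D p ∧ not (C (ι p)))) (𝟙 ∘ C ∘ ι))))
              (sum-mono (λ p → split (D p) (C (ι p)) (C⊑D p)))
  gg : g D ≤ g (C′ ∘ ι)
  gg = g-mono (λ v → adjoinAll-∋ ι D C v)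
  hh : h C ≤ h C′
  hh = h-mono (adjoinAll-⊒ ι D C)
  ring : ∀ c′ fc hc c s d ci gd gc hc′ →
    c′ + (fc + hc) + (c + s + (d + (ci + gd + (gc + hc′)))) ≡ c + (gc + hc′) + (c′ + (s + ci + (d + fc + (gd + hc))))
  ring = solve-∀

sum-injective≤1 : ∀ {m n} (f : Fin m → Fin n) → (∀ p q → f p ≡ f q → p ≡ q) → ∀ y →
  sum (λ j → 𝟙 (does (f j Fin.≟ y))) ≤ 1
sum-injective≤1 {zero} f inj y = z≤n
sum-injective≤1 {suc m} f inj y with f zero Fin.≟ y
... | no _ = sum-injective≤1 (f ∘ suc) (λ p q e → Fin.suc-injective (inj _ _ e)) y
... | yes refl = s≤s (≤-reflexive (trans (sum-cong-≗ none) (trans (sum-const m 0) (*-zeroʳ m))))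
  where
  none : ∀ j → 𝟙 (does (f (suc j) Fin.≟ f zero)) ≡ 0
  none j with f (suc j) Fin.≟ f zero
  ... | no _ = refl
  ... | yes e = contradiction (inj _ _ e) λ ()

-- The rank 1 gadget

inside : ∀ {n m} → Sub n → Vec (Fin n) m → Bool
inside C [] = true
inside C (x ∷ t) = C x ∧ inside C t

∧-true : ∀ {b c} → b ∧ c ≡ true → b ≡ true × c ≡ true
∧-true {true} {true} _ = refl , refl

inside⁻ : ∀ {n m} (C : Sub n) (t : Vec (Fin n) m) → inside C t ≡ true → ∀ x → x ∈ᵥ t → C x ≡ true
inside⁻ C (y ∷ t) e x (VecAny.here refl) = proj₁ (∧-true e)
inside⁻ C (y ∷ t) e x (VecAny.there x∈t) = inside⁻ C t (proj₂ (∧-true {C y} e)) x x∈t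

inside⁺ : ∀ {n m} (C : Sub n) (t : Vec (Fin n) m) → (∀ x → x ∈ᵥ t → C x ≡ true) → inside C t ≡ true
inside⁺ C [] h = refl
inside⁺ C (y ∷ t) h rewrite h y (VecAny.here refl) = inside⁺ C t (λ x → h x ∘ VecAny.there)

inside-mono : ∀ {n m} {C D : Sub n} → C ⊑ D → (t : Vec (Fin n) m) → inside C t ≡ true → inside D t ≡ true
inside-mono C⊑D t e = inside⁺ _ t (λ x x∈t → C⊑D x (inside⁻ _ t e x x∈t))

inside-map : ∀ {n k m} (C : Sub n) (φ : Fin k → Fin n) (t : Vec (Fin k) m) → inside C (map φ t) ≡ inside (C ∘ φ) t
inside-map C φ [] = refl
inside-map C φ (x ∷ t) = cong (C (φ x) ∧_) (inside-map C φ t)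

-- The omitted vertices are `inject₁ j` and `suc j`. Once `inject₁ j` is left out, the vertex
-- `suc j` has index `j` among the rest (`punchIn-inject₁`), whence the inner `punchIn j`.
pathEdge : ∀ {r} → Fin (suc r) → Vec (Fin (suc (suc r))) r
pathEdge j = tabulate (λ x → punchIn (inject₁ j) (punchIn j x))

punchIn-inject₁ : ∀ {n} (j : Fin n) → punchIn (inject₁ j) j ≡ suc j
punchIn-inject₁ zero = refl
punchIn-inject₁ (suc j) = cong suc (punchIn-inject₁ j)

∈-pathEdge : ∀ {r} (j : Fin (suc r)) y → inject₁ j ≢ y → suc j ≢ y → y ∈ᵥ pathEdge j
∈-pathEdge j y ≢₁ ≢₂ = subst (_∈ᵥ pathEdge j) eq (∈V.∈-tabulate⁺ _ (punchOut j≢z))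
  where
  z : Fin _
  z = punchOut ≢₁
  j≢z : j ≢ z
  j≢z j≡z = ≢₂ (trans (≡-sym (punchIn-inject₁ j)) (trans (cong (punchIn (inject₁ j)) j≡z) (Fin.punchIn-punchOut ≢₁)))
  eq : punchIn (inject₁ j) (punchIn j (punchOut j≢z)) ≡ y
  eq = trans (cong (punchIn (inject₁ j)) (Fin.punchIn-punchOut j≢z)) (Fin.punchIn-punchOut ≢₁)

∈-tabulate⁻ : ∀ {A : Set} {n} (f : Fin n → A) {y} → y ∈ᵥ tabulate f → ∃ λ i → y ≡ f i
∈-tabulate⁻ {n = suc n} f (VecAny.here e) = zero , e
∈-tabulate⁻ {n = suc n} f (VecAny.there m) with ∈-tabulate⁻ (f ∘ suc) m
... | i , e = suc i , e

∉-pathEdge₁ : ∀ {r} (j : Fin (suc r)) → ¬ (inject₁ j ∈ᵥ pathEdge j)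
∉-pathEdge₁ j m with ∈-tabulate⁻ _ m
... | x , e = Fin.punchInᵢ≢i (inject₁ j) _ (≡-sym e)

∉-pathEdge₂ : ∀ {r} (j : Fin (suc r)) → ¬ (suc j ∈ᵥ pathEdge j)
∉-pathEdge₂ j m with ∈-tabulate⁻ _ m
... | x , e = Fin.punchInᵢ≢i j x (≡-sym (Fin.punchIn-injective (inject₁ j) _ _ (trans (punchIn-inject₁ j) e)))

-- Both vertices omitted by `j` must be omitted by `i`. If `i ≢ j`, then `suc j` is not `suc i` and
-- must be `inject₁ i`; likewise `inject₁ j` must be `suc i`. Together this gives i = i + 2.
pathEdge-injective : ∀ {r} (i j : Fin (suc r)) → (∀ y → y ∈ᵥ pathEdge i → y ∈ᵥ pathEdge j) → i ≡ j
pathEdge-injective i j sub with i Fin.≟ j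
... | yes e = e
... | no i≢j = contradiction (trans (≡-sym (Fin.toℕ-inject₁ i)) (trans (cong toℕ i≡j+1) (cong suc j≡i+1))) (m≢1+n+m (toℕ i) {1})
  where
  i≡j+1 : inject₁ i ≡ suc j
  i≡j+1 with inject₁ i Fin.≟ suc j
  ... | yes e = e
  ... | no n = contradiction (sub _ (∈-pathEdge i (suc j) n (i≢j ∘ Fin.suc-injective))) (∉-pathEdge₂ j)
  j≡i+1 : toℕ j ≡ suc (toℕ i)
  j≡i+1 with suc i Fin.≟ inject₁ j
  ... | yes e = trans (≡-sym (Fin.toℕ-inject₁ j)) (≡-sym (cong toℕ e))
  ... | no n = contradiction (sub _ (∈-pathEdge i (inject₁ j) (i≢j ∘ Fin.inject₁-injective) n)) (∉-pathEdge₁ j)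

pathCount : ∀ {r} → Sub (suc (suc r)) → ℕ
pathCount {r} S = sum {suc r} (λ j → 𝟙 (inside S (pathEdge j)))

pathCount-mono : ∀ {r} {S T : Sub (suc (suc r))} → S ⊑ T → pathCount S ≤ pathCount T
pathCount-mono S⊑T = sum-mono (λ j → 𝟙-mono (inside-mono S⊑T (pathEdge j)))

pathCount≤ : ∀ {r} (S : Sub (suc (suc r))) → pathCount S ≤ suc r
pathCount≤ {r} S = size≤n (λ j → inside S (pathEdge j))

pathCount-full : ∀ {r} {S : Sub (suc (suc r))} → (∀ v → S v ≡ true) → pathCount S ≡ suc r
pathCount-full h = size-full (λ j → inside⁺ _ (pathEdge j) (λ x _ → h x))

≟-does-true : ∀ {n} {x y : Fin n} → x ≡ y → does (x Fin.≟ y) ≡ true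
≟-does-true {x = x} {y} e with x Fin.≟ y
... | yes _ = refl
... | no n = contradiction e n

-- If S misses a vertex y, only the edges omitting y can lie in S, and there are at most two of
-- them; on the other hand a set containing an edge has at least r ≥ 3 vertices.
pathCount<size : ∀ {r} → 3 ≤ r → (S : Sub (suc (suc r))) → ∀ x → S x ≡ true → suc (pathCount S) ≤ size S
pathCount<size {r} 3≤r S x Sx with Fin.all? (λ v → S v Bool.≟ true)
... | yes full = ≤-trans (s≤s (pathCount≤ S)) (≤-reflexive (≡-sym (size-full full)))
... | no ¬full with Fin.¬∀⟶∃¬ _ _ (λ v → S v Bool.≟ true) ¬full
... | y , ¬Sy with Fin.any? (λ j → inside S (pathEdge j) Bool.≟ true)
... | no none = begin
  suc (pathCount S) ≡⟨ cong suc zero-count ⟩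
  1                 ≡⟨ cong 𝟙 Sx ⟨
  𝟙 (S x)           ≤⟨ term≤sum (𝟙 ∘ S) x ⟩
  size S            ∎
  where
  open ≤-Reasoning
  zero-count : pathCount S ≡ 0
  zero-count = trans (sum-cong-≗ (λ j → cong 𝟙 (Bool.¬-not {inside S (pathEdge j)} {true} (λ e → none (j , e)))))
                     (trans (sum-const (suc r) 0) (*-zeroʳ (suc r)))
... | yes (j , inS) = ≤-by (+-mono-≤ two-missing (≤-trans (s≤s at-most-two) 3≤r)) (≤-reflexive bookkeeping)
  where
  hit : Fin (suc (suc r)) → ℕ
  hit v = 𝟙 (does (inject₁ j Fin.≟ v)) + 𝟙 (does (suc j Fin.≟ v))

  either : ∀ (i : Fin (suc r)) v → (inside S (pathEdge i) ≡ true) → S v ≢ true →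
    1 ≤ 𝟙 (does (inject₁ i Fin.≟ v)) + 𝟙 (does (suc i Fin.≟ v))
  either i v e ¬Sv with inject₁ i Fin.≟ v | suc i Fin.≟ v
  ... | yes _ | _ = s≤s z≤n
  ... | no _ | yes _ = s≤s z≤n
  ... | no a | no b = contradiction (inside⁻ S (pathEdge i) e v (∈-pathEdge i v a b)) ¬Sv

  at-most-two : pathCount S ≤ 2
  at-most-two = begin
    pathCount S
      ≤⟨ sum-mono (λ i → only (λ e → either i y e ¬Sy)) ⟩
    sum {suc r} (λ i → 𝟙 (does (inject₁ i Fin.≟ y)) + 𝟙 (does (suc i Fin.≟ y)))
      ≡⟨ ∑-distrib-+ {suc r} (λ i → 𝟙 (does (inject₁ i Fin.≟ y))) (λ i → 𝟙 (does (suc i Fin.≟ y))) ⟩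
    sum {suc r} (λ i → 𝟙 (does (inject₁ i Fin.≟ y))) + sum {suc r} (λ i → 𝟙 (does (suc i Fin.≟ y)))
      ≤⟨ +-mono-≤ (sum-injective≤1 inject₁ (λ _ _ → Fin.inject₁-injective) y) (sum-injective≤1 suc (λ _ _ → Fin.suc-injective) y) ⟩
    2 ∎
    where
    open ≤-Reasoning
    only : ∀ {b m} → (b ≡ true → 1 ≤ m) → 𝟙 b ≤ m
    only {true} h = h refl
    only {false} h = z≤n

  flip : ∀ {a b : Fin (suc (suc r))} → 𝟙 (does (a Fin.≟ b)) ≤ 𝟙 (does (b Fin.≟ a))
  flip {a} {b} with a Fin.≟ b
  ... | yes e = ≤-reflexive (cong 𝟙 (≡-sym (≟-does-true (≡-sym e))))
  ... | no _ = z≤n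

  two-missing : sum (𝟙 ∘ not ∘ S) ≤ 2
  two-missing = begin
    sum (𝟙 ∘ not ∘ S) ≤⟨ sum-mono (λ v → only (S v) (λ n → either j v inS n)) ⟩
    sum hit           ≤⟨ sum-mono (λ v → +-mono-≤ (flip {inject₁ j} {v}) (flip {suc j} {v})) ⟩
    sum (λ v → 𝟙 (does (v Fin.≟ inject₁ j)) + 𝟙 (does (v Fin.≟ suc j)))
                      ≡⟨ ∑-distrib-+ (λ v → 𝟙 (does (v Fin.≟ inject₁ j))) (λ v → 𝟙 (does (v Fin.≟ suc j))) ⟩
    sum (λ v → 𝟙 (does (v Fin.≟ inject₁ j))) + sum (λ v → 𝟙 (does (v Fin.≟ suc j)))
      ≤⟨ +-mono-≤ (sum-injective≤1 (λ v → v) (λ _ _ e → e) (inject₁ j)) (sum-injective≤1 (λ v → v) (λ _ _ e → e) (suc j)) ⟩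
    2 ∎
    where
    open ≤-Reasoning
    only : ∀ b {m} → (b ≢ true → 1 ≤ m) → 𝟙 (not b) ≤ m
    only true h = z≤n
    only false h = h (λ ())

  bookkeeping : suc (pathCount S) + (2 + r) ≡ size S + (sum (𝟙 ∘ not ∘ S) + suc (pathCount S))
  bookkeeping = trans (cong (suc (pathCount S) +_) (≡-sym (size-∁ S))) (ring (pathCount S) (sum (𝟙 ∘ not ∘ S)) (size S))
    where
    ring : ∀ p m s → suc p + (m + s) ≡ s + (m + suc p)
    ring = solve-∀

-- Γ disjoint copies of the path gadget hung on n old vertices: copy γ consists of the old vertex
-- anchor γ and r + 1 new ones, and it has rank 1, so all its vertices are parallel to the anchor.
module Gadgets (n r Γ : ℕ) (3≤r : 3 ≤ r) (anchor : Fin Γ → Fin n) where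

  N : ℕ
  N = n + Γ * suc r

  old : Fin n → Fin N
  old v = v ↑ˡ (Γ * suc r)

  fresh : Fin Γ → Fin (suc r) → Fin N
  fresh γ j = n ↑ʳ combine γ j

  place : Fin Γ → Fin (suc (suc r)) → Fin N
  place γ zero = old (anchor γ)
  place γ (suc j) = fresh γ j

  gadgetCount : Sub N → ℕ
  gadgetCount C = sum {Γ} (λ γ → pathCount (C ∘ place γ))

  gadgetCount-mono : Mono gadgetCount
  gadgetCount-mono C⊑D = sum-mono (λ γ → pathCount-mono (λ v → C⊑D (place γ v)))

  -- The old vertices are self-sufficient under the gadgets. With its anchor added, the trace of `C`
  -- on a gadget is nonempty, so `pathCount<size` leaves one point to spare; that point is the
  -- anchor, and the fresh points alone pay for the edges.
  gadgetCount≤ : ∀ C → size (C ∘ old) + gadgetCount C ≤ size C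
  gadgetCount≤ C = begin
    size (C ∘ old) + gadgetCount C
      ≤⟨ +-monoʳ-≤ (size (C ∘ old)) (sum-mono (λ γ → step (C ∘ place γ))) ⟩
    size (C ∘ old) + sum {Γ} (λ γ → size (C ∘ fresh γ))
      ≡⟨ cong (size (C ∘ old) +_) (sum-combine Γ (suc r) (λ j → 𝟙 (C (n ↑ʳ j)))) ⟨
    size (C ∘ old) + size (λ j → C (n ↑ʳ j))
      ≡⟨ sum-↑ n (𝟙 ∘ C) ⟨
    size C ∎
    where
    open ≤-Reasoning
    step : (S : Sub (suc (suc r))) → pathCount S ≤ size (S ∘ suc)
    step S = ≤-trans (pathCount-mono S⊑S₀) (s≤s⁻¹ (pathCount<size 3≤r S₀ zero refl))
      where
      S₀ : Sub (suc (suc r))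
      S₀ zero = true
      S₀ (suc v) = S (suc v)
      S⊑S₀ : S ⊑ S₀
      S⊑S₀ zero _ = refl
      S⊑S₀ (suc v) e = e

  Empty Full Closed : Sub N → Fin Γ → Set
  Empty C γ = ∀ v → C (place γ v) ≡ false
  Full C γ = ∀ v → C (place γ v) ≡ true
  Closed C γ = Empty C γ ⊎ Full C γ

  closed? : ∀ C γ → Dec (Closed C γ)
  closed? C γ = Fin.all? (λ v → C (place γ v) Bool.≟ false) ⊎-dec Fin.all? (λ v → C (place γ v) Bool.≟ true)

  module FillGadget (C : Sub N) (γ : Fin Γ) (¬closed : ¬ Closed C γ) where
    C₁ : Sub N
    C₁ = adjoinAll (place γ) (λ _ → true) C

    ⊒ : C ⊑ C₁
    ⊒ = adjoinAll-⊒ (place γ) (λ _ → true) C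

    full : Full C₁ γ
    full v = adjoinAll-∋ (place γ) (λ _ → true) C v refl

    touched : ∃ λ v → C (place γ v) ≡ true
    touched with Fin.¬∀⟶∃¬ _ _ (λ v → C (place γ v) Bool.≟ false) (¬closed ∘ inj₁)
    ... | v , ne = v , Bool.¬-not ne

    missed : ∃ λ v → C (place γ v) ≡ false
    missed with Fin.¬∀⟶∃¬ _ _ (λ v → C (place γ v) Bool.≟ true) (¬closed ∘ inj₂)
    ... | v , ne = v , Bool.¬-not ne

    missing : ℕ
    missing = sum (λ v → 𝟙 (not (C (place γ v))))

    -- Filling brings at least as many edges as points: the touched trace S has at most |S| - 1
    -- edges, the full gadget has r + 1, and |S| + `missing` = r + 2. The other gadgets can only
    -- gain.
    gain : missing + gadgetCount C ≤ gadgetCount C₁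
    gain = sum-gain missing γ (λ γ′ → pathCount-mono (λ v → ⊒ (place γ′ v))) (begin
      missing + pathCount S ≤⟨ s≤s⁻¹ (begin
        suc (missing + pathCount S) ≡⟨ +-suc missing _ ⟨
        missing + suc (pathCount S) ≤⟨ +-monoʳ-≤ missing (pathCount<size 3≤r S (proj₁ touched) (proj₂ touched)) ⟩
        missing + size S            ≡⟨ size-∁ S ⟩
        suc (suc r)                 ∎) ⟩
      suc r                 ≡⟨ pathCount-full full ⟨
      pathCount (C₁ ∘ place γ) ∎)
      where
      open ≤-Reasoning
      S : Sub (suc (suc r))
      S = C ∘ place γ

    δ-decreases : size C₁ + gadgetCount C ≤ size C + gadgetCount C₁
    δ-decreases = ≤-by (+-mono-≤ (size-adjoinAll (place γ) (λ _ → true) C) gain)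
                       (≤-reflexive (ring (size C₁) (gadgetCount C) (size C) missing (gadgetCount C₁)))
      where
      ring : ∀ c₁ g c m g₁ → c₁ + g + (c + m + g₁) ≡ c + g₁ + (c₁ + (m + g))
      ring = solve-∀

    grows : size C < size C₁
    grows = sum-gain 1 (place γ (proj₁ missed)) (λ v → 𝟙-mono (⊒ v))
      (strict (proj₂ missed) (full (proj₁ missed)))
      where
      strict : ∀ {b c} → b ≡ false → c ≡ true → 1 + 𝟙 b ≤ 𝟙 c
      strict refl refl = ≤-refl

  -- Filling a gadget adds its anchor and may open other gadgets hung on the same old vertex, so one
  -- pass over the gadgets is not enough. The process ends because every filling enlarges the set;
  -- the fuel bounds the number of points still absent.
  close : ∀ C → Σ (Sub N) λ D → C ⊑ D × (∀ γ → Closed D γ) × size D + gadgetCount C ≤ size C + gadgetCount D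
  close C = go N C (m≤m+n N (size C))
    where
    go : ∀ fuel C → N ≤ fuel + size C →
      Σ (Sub N) λ D → C ⊑ D × (∀ γ → Closed D γ) × size D + gadgetCount C ≤ size C + gadgetCount D
    go fuel C enough with Fin.all? (closed? C)
    ... | yes closed = C , (λ _ e → e) , closed , ≤-refl
    ... | no ¬closed with Fin.¬∀⟶∃¬ _ _ (closed? C) ¬closed
    go zero C enough | no _ | γ , ¬c =
      contradiction (≤-trans (FillGadget.grows C γ ¬c) (≤-trans (size≤n (FillGadget.C₁ C γ ¬c)) enough)) (n≮n _)
    go (suc fuel) C enough | no _ | γ , ¬c
      with go fuel (FillGadget.C₁ C γ ¬c)
              (≤-trans enough (≤-trans (≤-reflexive (≡-sym (+-suc fuel (size C)))) (+-monoʳ-≤ fuel (FillGadget.grows C γ ¬c))))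
    ... | D , ⊑D , closed , δ = D , (λ v → ⊑D v ∘ Fill.⊒ v) , closed ,
      ≤-by (+-mono-≤ Fill.δ-decreases δ)
           (≤-reflexive (ring (size D) (gadgetCount C) (size C) (gadgetCount Fill.C₁) (size Fill.C₁) (gadgetCount D)))
      where
      module Fill = FillGadget C γ ¬c
      ring : ∀ d gc c g₁ c₁ gd → d + gc + (c + g₁ + (c₁ + gd)) ≡ c + gd + (c₁ + gc + (d + g₁))
      ring = solve-∀

-- Counting facts

Inj : ∀ {A B : Set} → (A → B) → Set
Inj f = ∀ p q → f p ≡ f q → p ≡ q

AllPairs-lookup : ∀ {A : Set} {D : A → A → Set} {xs} → AllPairs D xs → ∀ {i j} → i F.< j → D (List.lookup xs i) (List.lookup xs j)
AllPairs-lookup {xs = x ∷ xs} (px ∷ _) {zero} {suc j} _ = All.lookup px (∈P.∈-lookup j)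
AllPairs-lookup {xs = x ∷ xs} (_ ∷ ap) {suc i} {suc j} i<j = AllPairs-lookup ap (s≤s⁻¹ i<j)

-- Distinctness is a parameter because facts are compared up to `Same` and not up to equality.
-- Sending an entry of `xs` to the position of a partner in `ys` is injective, since `clash` forbids
-- distinct entries with a common partner.
length-pigeonhole : ∀ {A B : Set} {D : A → A → Set} {R : A → B → Set} {xs ys} →
  AllPairs D xs → (∀ {x x′ y} → R x y → R x′ y → ¬ D x x′) →
  (∀ {x} → x ∈ xs → Any (R x) ys) → length xs ≤ length ys
length-pigeonhole {D = D} {R} {xs} {ys} distinct clash cover = Fin.injective⇒≤ {f = f} f-injective
  where
  f : Fin (length xs) → Fin (length ys)
  f i = Any.index (cover (∈P.∈-lookup i))
  related : ∀ i → R (List.lookup xs i) (List.lookup ys (f i))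
  related i = AnyP.lookup-index (cover (∈P.∈-lookup i))
  separate : ∀ {i j} → i F.< j → f i ≢ f j
  separate {i} {j} i<j e = clash (related i) (subst (R (List.lookup xs j) ∘ List.lookup ys) (≡-sym e) (related j)) (AllPairs-lookup distinct i<j)
  f-injective : ∀ {i j} → f i ≡ f j → i ≡ j
  f-injective {i} {j} e with Fin.<-cmp i j
  ... | tri< i<j _ _ = contradiction e (separate i<j)
  ... | tri≈ _ i≡j _ = i≡j
  ... | tri> _ _ j<i = contradiction (≡-sym e) (separate j<i)

Unique-⊆-length : ∀ {A : Set} {xs ys : List A} → Unique xs → (∀ x → x ∈ xs → x ∈ ys) → length xs ≤ length ys
Unique-⊆-length u sub = length-pigeonhole u (λ { refl refl ne → ne refl }) (sub _)

∈ᵥ-map⁻ : ∀ {A B : Set} {m} (f : A → B) {t : Vec A m} {y} → y ∈ᵥ map f t → ∃ λ x → x ∈ᵥ t × y ≡ f x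
∈ᵥ-map⁻ f y∈ = ∈V.fromAny (VecAnyP.map⁻ y∈)

map-injective : ∀ {A B : Set} {f : A → B} → Inj f → ∀ {m} (t u : Vec A m) → map f t ≡ map f u → t ≡ u
map-injective inj [] [] _ = refl
map-injective inj (x ∷ t) (y ∷ u) e = cong₂ _∷_ (inj _ _ (cong Vec.head e)) (map-injective inj t u (cong Vec.tail e))

unmap : ∀ {A B : Set} (f : A → B) {m} (t : Vec B m) → (∀ y → y ∈ᵥ t → ∃ λ x → f x ≡ y) → ∃ λ u → t ≡ map f u
unmap f [] h = [] , refl
unmap f (y ∷ t) h with h y (VecAny.here refl) | unmap f t (λ z → h z ∘ VecAny.there)
... | x , refl | u , refl = x ∷ u , refl

module Counting (L : Lang) where
  open Lang L

  -- A fact without the proofs and the ambient set that `Fact` carries, so that one object can be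
  -- counted in different sets and structures.
  Key : Set → Set
  Key X = Σ I λ i → Vec X (ar i)

  Same : Mode → ∀ {X} → Key X → Key X → Set
  Same gen κ l = κ ≡ l
  Same sym (i , t) (j , u) = (i ≡ j) × (∀ x → x ∈ᵥ t ⟺ x ∈ᵥ u)

  Within : ∀ {X} → (X → Set) → Key X → Set
  Within P (i , t) = ∀ x → x ∈ᵥ t → P x

  Holds : ∀ {X} → Str L X → Key X → Set
  Holds S (i , t) = R S i t

  mapKey : ∀ {X Y} → (X → Y) → Key X → Key Y
  mapKey f (i , t) = i , map f t

  Same-refl : ∀ μ {X} (κ : Key X) → Same μ κ κ
  Same-refl gen κ = refl
  Same-refl sym κ = refl , λ x → id , id

  Same-sym : ∀ μ {X} {κ l : Key X} → Same μ κ l → Same μ l κ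
  Same-sym gen refl = refl
  Same-sym sym (e , h) = ≡-sym e , λ x → proj₂ (h x) , proj₁ (h x)

  Same-trans : ∀ μ {X} {κ l m : Key X} → Same μ κ l → Same μ l m → Same μ κ m
  Same-trans gen refl e = e
  Same-trans sym (refl , h) (refl , g) = refl , λ x → proj₁ (g x) ∘ proj₁ (h x) , proj₂ (h x) ∘ proj₂ (g x)

  Same⇒sym : ∀ μ {X} {κ l : Key X} → Same μ κ l → Same sym κ l
  Same⇒sym gen {κ = κ} refl = Same-refl sym κ
  Same⇒sym sym s = s

  Same-support : ∀ μ {X} {κ l : Key X} → Same μ κ l → ∀ x → x ∈ᵥ proj₂ κ → x ∈ᵥ proj₂ l
  Same-support μ s x = proj₁ (proj₂ (Same⇒sym μ s) x)

  Same-Within : ∀ μ {X} {κ l : Key X} {P : X → Set} → Same μ κ l → Within P l → Within P κ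
  Same-Within μ s w x x∈ = w x (Same-support μ s x x∈)

  Same-map⁺ : ∀ μ {X Y} (f : X → Y) {κ l : Key X} → Same μ κ l → Same μ (mapKey f κ) (mapKey f l)
  Same-map⁺ gen f refl = refl
  Same-map⁺ sym f {_ , t} {_ , u} (e , h) = e , λ y → transfer t u (proj₁ ∘ h) , transfer u t (proj₂ ∘ h)
    where
    transfer : ∀ {m n} (t : Vec _ m) (u : Vec _ n) → (∀ x → x ∈ᵥ t → x ∈ᵥ u) → ∀ {y} → y ∈ᵥ map f t → y ∈ᵥ map f u
    transfer t u sub y∈ with ∈ᵥ-map⁻ f y∈
    ... | x , x∈ , refl = ∈V.∈-map⁺ f (sub x x∈)

  ,-≡⁻ : ∀ {X} {i j} {t : Vec X (ar i)} {u : Vec X (ar j)} → _≡_ {A = Key X} (i , t) (j , u) →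
    Σ (i ≡ j) λ e → subst (Vec X ∘ ar) e t ≡ u
  ,-≡⁻ refl = refl , refl

  Same-map⁻ : ∀ μ {X Y} {f : X → Y} → Inj f → {κ l : Key X} → Same μ (mapKey f κ) (mapKey f l) → Same μ κ l
  Same-map⁻ gen inj {i , t} {j , u} e with ,-≡⁻ e
  ... | refl , q = cong (i ,_) (map-injective inj t u q)
  Same-map⁻ sym {f = f} inj {i , t} {j , u} (e , h) = e , λ x →
    reflect t u (proj₁ (h (f x))) , reflect u t (proj₂ (h (f x)))
    where
    reflect : ∀ {m n x} (t : Vec _ m) (u : Vec _ n) → (f x ∈ᵥ map f t → f x ∈ᵥ map f u) → x ∈ᵥ t → x ∈ᵥ u
    reflect t u sub x∈ with ∈ᵥ-map⁻ f (sub (∈V.∈-map⁺ f x∈))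
    ... | y , y∈ , fx≡fy with inj _ _ fx≡fy
    ... | refl = y∈

  -- `FactCount` for a predicate instead of a list. The enumeration is genuine data: it cannot be
  -- computed from an undecidable relation and has to be handed on from the class condition.
  Cnt : Mode → ∀ {X} → Str L X → (X → Set) → ℕ → Set
  Cnt μ {X} S P m = Σ (List (Key X)) λ ks →
    AllPairs (λ κ l → ¬ Same μ κ l) ks ×
    All (λ κ → Holds S κ × Within P κ) ks ×
    (∀ κ → Holds S κ → Within P κ → Any (Same μ κ) ks) ×
    length ks ≡ m

  Cnt-mono : ∀ {μ X} {S S′ : Str L X} {P Q : X → Set} {m m′} → Cnt μ S P m → Cnt μ S′ Q m′ →
    (∀ κ → Holds S κ → Within P κ → Holds S′ κ × Within Q κ) → m ≤ m′
  Cnt-mono {μ} (ks , distinct , ok , _ , refl) (_ , _ , _ , cover , refl) sub =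
    length-pigeonhole distinct (λ s s′ ne → ne (Same-trans μ s (Same-sym μ s′)))
      (λ {κ} κ∈ → let h , w = All.lookup ok κ∈ ; h′ , w′ = sub κ h w in cover κ h′ w′)

  Cnt-resp : ∀ {μ X} {S : Str L X} {P Q : X → Set} {m} → (∀ x → P x ⟺ Q x) → Cnt μ S P m → Cnt μ S Q m
  Cnt-resp P⟺Q (ks , distinct , ok , cover , len) =
    ks , distinct , All.map (λ { (h , w) → h , λ x x∈ → proj₁ (P⟺Q x) (w x x∈) }) ok ,
    (λ κ h w → cover κ h (λ x x∈ → proj₂ (P⟺Q x) (w x x∈))) , len

  Cnt-unique : ∀ {μ X} {S : Str L X} {P : X → Set} {m m′} → Cnt μ S P m → Cnt μ S P m′ → m ≡ m′
  Cnt-unique c c′ = ≤-antisym (Cnt-mono c c′ (λ _ → _,_)) (Cnt-mono c′ c (λ _ → _,_))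

  module _ {μ : Mode} {X : Set} {S : Str L X} {A : List X} where

    toKey : Fact L μ S A → Key X
    toKey f = Fact.rel f , Fact.tup f

    sameFact⁺ : ∀ ν {f g : Fact L μ S A} → Same ν (toKey f) (toKey g) → SameFact' L μ S ν f g
    sameFact⁺ gen s = s
    sameFact⁺ sym s = s

    sameFact⁻ : ∀ ν {f g : Fact L μ S A} → SameFact' L μ S ν f g → Same ν (toKey f) (toKey g)
    sameFact⁻ gen s = s
    sameFact⁻ sym s = s

    FactCount⇒Cnt : ∀ {m} → FactCount L μ S A m → Cnt μ S (_∈ A) m
    FactCount⇒Cnt (fs , distinct , cover , len) =
      List.map toKey fs ,
      AllPairsP.map⁺ (AllPairs.map (λ n s → n (sameFact⁺ μ s)) distinct) ,
      AllP.map⁺ (All.tabulate (λ {f} _ → Fact.holds f , Fact.inA f)) ,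
      (λ { (i , t) h w → AnyP.map⁺ (Any.map (sameFact⁻ μ) (cover (fact i t h w))) }) ,
      trans (List.length-map toKey fs) len

    Cnt⇒FactCount : ∀ {m} → Cnt μ S (_∈ A) m → FactCount L μ S A m
    Cnt⇒FactCount (ks , distinct , ok , cover , refl) with facts ks ok
      where
      facts : ∀ ks → All (λ κ → Holds S κ × Within (_∈ A) κ) ks → Σ (List (Fact L μ S A)) λ fs → List.map toKey fs ≡ ks
      facts [] [] = [] , refl
      facts ((i , t) ∷ ks) ((h , w) ∷ ok) with facts ks ok
      ... | fs , refl = fact i t h w ∷ fs , refl
    ... | fs , refl =
      fs ,
      AllPairs.map (λ n s → n (sameFact⁻ μ s)) (AllPairsP.map⁻ distinct) ,
      (λ f → Any.map (sameFact⁺ μ) (AnyP.map⁻ (cover (toKey f) (Fact.holds f) (Fact.inA f)))) ,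
      ≡-sym (List.length-map toKey fs)

  Image : ∀ {W V : Set} → (W → V) → V → Set
  Image ι v = ∃ λ w → ι w ≡ v

  unmapKey : ∀ {W V} (ι : W → V) (κ : Key V) → Within (Image ι) κ → ∃ λ l → κ ≡ mapKey ι l
  unmapKey ι (i , t) w with unmap ι t w
  ... | u , refl = (i , u) , refl

  -- Transported facts lie within the image of `ι` and those in `new` do not, so the two lists can
  -- be concatenated without repetition. The alternative `either` is passed in, as nothing here
  -- decides whether a fact lies within the image.
  Cnt-extend : ∀ {μ W V} {S₀ : Str L W} {S : Str L V} {P : V → Set} {ι : W → V} → Inj ι →
    (∀ κ → Holds S₀ κ ⟺ Holds S (mapKey ι κ)) →
    (new : List (Key V)) → AllPairs (λ κ l → ¬ Same μ κ l) new →
    All (λ κ → ¬ Within (Image ι) κ) new →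
    All (λ κ → Holds S κ × Within P κ) new →
    (∀ κ → Holds S κ → Within P κ → Within (Image ι) κ ⊎ Any (Same μ κ) new) →
    ∀ {m} → Cnt μ S₀ (P ∘ ι) m → Cnt μ S P (m + length new)
  Cnt-extend {μ} {S = S} {P} {ι} inj iff new new-distinct outside new-ok either (ks , distinct , ok , cover , refl) =
    List.map (mapKey ι) ks List.++ new ,
    AllPairsP.++⁺ (AllPairsP.map⁺ (AllPairs.map (λ n s → n (Same-map⁻ μ inj s)) distinct)) new-distinct
      (AllP.map⁺ (All.tabulate (λ {κ} _ → All.map (λ out s → out (Same-Within μ (Same-sym μ s) (mapped κ))) outside))) ,
    AllP.++⁺ (AllP.map⁺ (All.map (λ {κ} (h , w) → proj₁ (iff κ) h , within κ w) ok)) new-ok ,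
    covered ,
    trans (List.length-++ (List.map (mapKey ι) ks)) (cong (_+ length new) (List.length-map (mapKey ι) ks))
    where
    mapped : ∀ κ → Within (Image ι) (mapKey ι κ)
    mapped (i , t) x x∈ with ∈ᵥ-map⁻ ι x∈
    ... | y , _ , e = y , ≡-sym e
    within : ∀ κ → Within (P ∘ ι) κ → Within P (mapKey ι κ)
    within (i , t) w x x∈ with ∈ᵥ-map⁻ ι x∈
    ... | y , y∈ , refl = w y y∈
    covered : ∀ κ → Holds S κ → Within P κ → Any (Same μ κ) (List.map (mapKey ι) ks List.++ new)
    covered κ h w with either κ h w
    ... | inj₂ s = AnyP.++⁺ʳ _ s
    ... | inj₁ im with unmapKey ι κ im
    ... | l , refl = AnyP.++⁺ˡ (AnyP.map⁺ (Any.map (Same-map⁺ μ ι) (cover l (proj₂ (iff l) h) (λ y y∈ → w (ι y) (∈V.∈-map⁺ ι y∈)))))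

  induced : ∀ {W X} → Str L X → (W → X) → Str L W
  induced S a = record { R = λ i t → R S i (map a t) }

  Cnt-pull : ∀ {μ W X} {S : Str L X} {P : X → Set} {a : W → X} → Inj a → (∀ x → P x → Image a x) →
    ∀ {m} → Cnt μ S P m → Cnt μ (induced S a) (P ∘ a) m
  Cnt-pull {μ} {W} {S = S} {P} {a} inj P⊆a (ks , distinct , ok , cover , refl)
    with unmapAll ks (All.map (λ (h , w) x x∈ → P⊆a x (w x x∈)) ok)
    where
    unmapAll : ∀ ks → All (Within (Image a)) ks → ∃ λ ls → ks ≡ List.map (mapKey a) ls
    unmapAll [] [] = [] , refl
    unmapAll (κ ∷ ks) (w ∷ ws) with unmapKey a κ w | unmapAll ks ws
    ... | l , refl | ls , refl = l ∷ ls , refl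
  ... | ls , refl =
    ls ,
    AllPairs.map (λ n s → n (Same-map⁺ μ a s)) (AllPairsP.map⁻ distinct) ,
    All.map (λ (h , w) → h , λ y y∈ → w (a y) (∈V.∈-map⁺ a y∈)) (AllP.map⁻ ok) ,
    (λ κ h w → Any.map (Same-map⁻ μ inj) (AnyP.map⁻ (cover (mapKey a κ) h (within κ w)))) ,
    ≡-sym (List.length-map (mapKey a) ls)
    where
    within : ∀ κ → Within (P ∘ a) κ → Within P (mapKey a κ)
    within (i , t) w x x∈ with ∈ᵥ-map⁻ a x∈
    ... | y , y∈ , refl = w y y∈

-- Finite structures in the two classes

elems : ∀ {k} {X : Set} → (Fin k → X) → Sub k → List X
elems {zero} a C = []
elems {suc k} a C = if C zero then a zero ∷ elems (a ∘ suc) (C ∘ suc) else elems (a ∘ suc) (C ∘ suc)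

∈-elems⁺ : ∀ {k} {X : Set} (a : Fin k → X) C p → C p ≡ true → a p ∈ elems a C
∈-elems⁺ {suc k} a C zero e rewrite e = here refl
∈-elems⁺ {suc k} a C (suc p) e with C zero
... | true = there (∈-elems⁺ (a ∘ suc) (C ∘ suc) p e)
... | false = ∈-elems⁺ (a ∘ suc) (C ∘ suc) p e

∈-elems⁻ : ∀ {k} {X : Set} (a : Fin k → X) C {x} → x ∈ elems a C → ∃ λ p → C p ≡ true × a p ≡ x
∈-elems⁻ {suc k} a C x∈ with C zero in eq
∈-elems⁻ {suc k} a C (here refl) | true = zero , eq , refl
∈-elems⁻ {suc k} a C (there x∈) | true with ∈-elems⁻ (a ∘ suc) (C ∘ suc) x∈
... | p , e , q = suc p , e , q
∈-elems⁻ {suc k} a C x∈ | false with ∈-elems⁻ (a ∘ suc) (C ∘ suc) x∈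
... | p , e , q = suc p , e , q

∈-elems⇔ : ∀ {k} {X : Set} {a : Fin k → X} → Inj a → ∀ C p → a p ∈ elems a C ⟺ C p ≡ true
∈-elems⇔ {a = a} inj C p = (λ ap∈ → back (∈-elems⁻ a C ap∈)) , ∈-elems⁺ a C p
  where
  back : (∃ λ q → C q ≡ true × a q ≡ a p) → C p ≡ true
  back (q , e , r) = subst (λ p → C p ≡ true) (inj _ _ r) e

length-elems : ∀ {k} {X : Set} (a : Fin k → X) C → length (elems a C) ≡ size C
length-elems {zero} a C = refl
length-elems {suc k} a C with C zero
... | true = cong suc (length-elems (a ∘ suc) (C ∘ suc))
... | false = length-elems (a ∘ suc) (C ∘ suc)

elems-unique : ∀ {k} {X : Set} {a : Fin k → X} → Inj a → ∀ C → Unique (elems a C)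
elems-unique {zero} inj C = []
elems-unique {suc k} {a = a} inj C with C zero
... | true = All.tabulate fresh ∷ elems-unique (λ p q e → Fin.suc-injective (inj _ _ e)) (C ∘ suc)
  where
  fresh : ∀ {x} → x ∈ elems (a ∘ suc) (C ∘ suc) → a zero ≢ x
  fresh x∈ e with ∈-elems⁻ (a ∘ suc) (C ∘ suc) x∈
  ... | p , _ , q with inj _ _ (trans e (≡-sym q))
  ... | ()
... | false = elems-unique (λ p q e → Fin.suc-injective (inj _ _ e)) (C ∘ suc)

record Trace {k} {X : Set} (a : Fin k → X) (A : List X) : Set where
  field
    trace : Sub k
    trace-∈ : ∀ p → trace p ≡ true ⟺ a p ∈ A
    trace-size : Unique A → size trace ≡ length A

-- Equality on `X` is not decidable, so each element of `A` is first replaced by an index, and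
-- membership is then decided among indices.
traceOf : ∀ {k} {X : Set} {a : Fin k → X} → Inj a → ∀ A → (∀ x → x ∈ A → ∃ λ p → a p ≡ x) → Trace a A
traceOf {k} {X} {a} inj A A⊆a = record { trace = C ; trace-∈ = C-∈ ; trace-size = C-size }
  where
  indices : ∀ A → (∀ x → x ∈ A → ∃ λ p → a p ≡ x) → ∃ λ ps → A ≡ List.map a ps
  indices [] h = [] , refl
  indices (x ∷ A) h with h x (here refl) | indices A (λ y → h y ∘ there)
  ... | p , refl | ps , refl = p ∷ ps , refl
  ps : List (Fin k)
  ps = proj₁ (indices A A⊆a)
  A≡ : A ≡ List.map a ps
  A≡ = proj₂ (indices A A⊆a)
  C : Sub k
  C p = does (_∈?_ Fin._≟_ p ps)
  C-∈ : ∀ p → C p ≡ true ⟺ a p ∈ A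
  C-∈ p with _∈?_ Fin._≟_ p ps
  ... | yes p∈ = (λ _ → subst (a p ∈_) (≡-sym A≡) (∈P.∈-map⁺ a p∈)) , λ _ → refl
  ... | no p∉ = (λ ()) , λ ap∈ → contradiction (reflect ap∈) p∉
    where
    reflect : a p ∈ A → p ∈ ps
    reflect ap∈ with ∈P.∈-map⁻ a (subst (a p ∈_) A≡ ap∈)
    ... | q , q∈ , e = subst (_∈ ps) (≡-sym (inj _ _ e)) q∈
  C-size : Unique A → size C ≡ length A
  C-size u = trans (≡-sym (length-elems a C)) (≤-antisym
    (Unique-⊆-length (elems-unique inj C) to) (Unique-⊆-length u from))
    where
    to : ∀ x → x ∈ elems a C → x ∈ A
    to x x∈ with ∈-elems⁻ a C x∈
    ... | p , e , refl = proj₁ (C-∈ p) e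
    from : ∀ x → x ∈ A → x ∈ elems a C
    from x x∈ with A⊆a x x∈
    ... | p , refl = ∈-elems⁺ a C p (proj₂ (C-∈ p) x∈)

-- Pigeonhole: the `suc m` different entries of `t` all occur in `u`, which has just as many
-- positions. If two of these held the same entry, one could be avoided and `suc m` entries would
-- fit injectively into `m` positions.
InjTuple-resp : ∀ (L : Lang) {X : Set} {m} (t u : Vec X m) → (∀ x → x ∈ᵥ t → x ∈ᵥ u) → InjTuple L t → InjTuple L u
InjTuple-resp L {m = suc m} t u sub inj p q u-eq with p Fin.≟ q
... | yes e = e
... | no p≢q = contradiction (Fin.injective⇒≤ {f = g} g-injective) (n≮n _)
  where
  f : Fin (suc m) → Fin (suc m)
  f x = VecAny.index (sub _ (∈V.∈-lookup x t))
  f-lookup : ∀ x → lookup t x ≡ lookup u (f x)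
  f-lookup x = VecAnyP.lookup-index (sub _ (∈V.∈-lookup x t))
  -- redirects the second occurrence q of the repeated entry to the first one
  avoid : ∀ y → ∃ λ z → q ≢ z × lookup u z ≡ lookup u y
  avoid y with q Fin.≟ y
  ... | yes refl = p , (λ e → p≢q (≡-sym e)) , u-eq
  ... | no q≢y = y , q≢y , refl
  g : Fin (suc m) → Fin m
  g x = F.punchOut (proj₁ (proj₂ (avoid (f x))))
  g-injective : ∀ {x y} → g x ≡ g y → x ≡ y
  g-injective {x} {y} e = inj x y (trans (f-lookup x) (trans (≡-sym (proj₂ (proj₂ (avoid (f x)))))
    (trans (cong (lookup u) (Fin.punchOut-injective (proj₁ (proj₂ (avoid (f x)))) (proj₁ (proj₂ (avoid (f y)))) e)) (trans (proj₂ (proj₂ (avoid (f y)))) (≡-sym (f-lookup y))))))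

module Classes (L : Lang) where
  open Lang L
  open Counting L

  -- Class membership apart from the predimension. For a variable mode `InClass` does not reduce;
  -- splitting it here once lets the later constructions treat both classes together.
  Tame : Mode → ∀ {X} → Str L X → Set
  Tame gen S = ⊤
  Tame sym S = (∀ i t → R S i t → InjTuple L t) × (∀ i t u → (∀ x → x ∈ᵥ t ⟺ x ∈ᵥ u) → R S i t → R S i u)

  InClass⇒Tame : ∀ μ {X} {S : Str L X} → InClass L μ S → Tame μ S
  InClass⇒Tame gen c = tt
  InClass⇒Tame sym (inj , symm , _) = inj , symm

  InClass⇒δ≥0 : ∀ μ {X} {S : Str L X} → InClass L μ S → ∀ A → Unique A → δ≥0 L μ S A
  InClass⇒δ≥0 gen c = c
  InClass⇒δ≥0 sym (_ , _ , c) = c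

  toInClass : ∀ μ {X} {S : Str L X} → Tame μ S → (∀ A → Unique A → δ≥0 L μ S A) → InClass L μ S
  toInClass gen _ c = c
  toInClass sym (inj , symm) c = inj , symm , c

  InjTuple-map⁻ : ∀ {X Y : Set} (f : X → Y) {m} (t : Vec X m) → InjTuple L (map f t) → InjTuple L t
  InjTuple-map⁻ f t inj p q e = inj p q (trans (Vec.lookup-map p f t) (trans (cong f e) (≡-sym (Vec.lookup-map q f t))))

  InjTuple-map⁺ : ∀ {X Y : Set} {f : X → Y} → Inj f → ∀ {m} (t : Vec X m) → InjTuple L t → InjTuple L (map f t)
  InjTuple-map⁺ {f = f} f-inj t inj p q e =
    inj p q (f-inj _ _ (trans (≡-sym (Vec.lookup-map p f t)) (trans e (Vec.lookup-map q f t))))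

  induced-Tame : ∀ μ {X W} {S : Str L X} (a : W → X) → Tame μ S → Tame μ (induced S a)
  induced-Tame gen a _ = tt
  induced-Tame sym a (inj , symm) =
    (λ i t h → InjTuple-map⁻ a t (inj i (map a t) h)) ,
    (λ i t u s h → symm i (map a t) (map a u) (proj₂ (Same-map⁺ sym a {i , t} {i , u} (refl , s))) h)

  ⟦_⟧ : ∀ {n} → Sub n → Fin n → Set
  ⟦ C ⟧ v = C v ≡ true

  hits : ∀ {n} → Sub n → List (Key (Fin n)) → ℕ
  hits C [] = 0
  hits C (κ ∷ ks) = 𝟙 (inside C (proj₂ κ)) + hits C ks

  hits-mono : ∀ {n} (ks : List (Key (Fin n))) → Mono (λ C → hits C ks)
  hits-mono [] C⊑D = z≤n
  hits-mono (κ ∷ ks) C⊑D = +-mono-≤ (𝟙-mono (inside-mono C⊑D (proj₂ κ))) (hits-mono ks C⊑D)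

  hits-++ : ∀ {n} (C : Sub n) ks ls → hits C (ks List.++ ls) ≡ hits C ks + hits C ls
  hits-++ C [] ls = refl
  hits-++ C (κ ∷ ks) ls = trans (cong (𝟙 (inside C (proj₂ κ)) +_) (hits-++ C ks ls)) (≡-sym (+-assoc (𝟙 (inside C (proj₂ κ))) _ _))

  hits-tabulate : ∀ {n m} (C : Sub n) (f : Fin m → Key (Fin n)) → hits C (List.tabulate f) ≡ sum (λ j → 𝟙 (inside C (proj₂ (f j))))
  hits-tabulate {m = zero} C f = refl
  hits-tabulate {m = suc m} C f = cong (𝟙 (inside C (proj₂ (f zero))) +_) (hits-tabulate C (f ∘ suc))

  inside? : ∀ {n} (C : Sub n) (κ : Key (Fin n)) → Dec (inside C (proj₂ κ) ≡ true)
  inside? C κ = inside C (proj₂ κ) Bool.≟ true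

  selected : ∀ {n} → Sub n → List (Key (Fin n)) → List (Key (Fin n))
  selected C = List.filter (inside? C)

  length-selected : ∀ {n} (C : Sub n) ks → length (selected C ks) ≡ hits C ks
  length-selected C [] = refl
  length-selected C (κ ∷ ks) with inside C (proj₂ κ)
  ... | true = cong suc (length-selected C ks)
  ... | false = length-selected C ks

  selected-All : ∀ {n} {P : Key (Fin n) → Set} (C : Sub n) {ks} → All P ks → All (λ κ → P κ × Within ⟦ C ⟧ κ) (selected C ks)
  selected-All C {ks} all = All.zipWith id (AllP.filter⁺ (inside? C) all , All.map (λ {κ} → inside⁻ C (proj₂ κ)) (AllP.all-filter (inside? C) ks))

  selected-Any : ∀ {n} μ (C : Sub n) {κ} ks → Within ⟦ C ⟧ κ → Any (Same μ κ) ks → Any (Same μ κ) (selected C ks)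
  selected-Any μ C ks w s with AnyP.filter⁺ (inside? C) s
  ... | inj₁ s′ = s′
  ... | inj₂ ¬in = contradiction (inside⁺ C _ (Same-Within μ (Same-sym μ (AnyP.lookup-result s)) w)) ¬in

  -- A single enumeration serves all subsets of `P` at once, because a `Sub` is Boolean and can
  -- filter the list.
  Cnt-hits : ∀ {μ n} {S : Str L (Fin n)} {P : Fin n → Set} {m} ((ks , _) : Cnt μ S P m) →
    ∀ C → (∀ v → C v ≡ true → P v) → Cnt μ S ⟦ C ⟧ (hits C ks)
  Cnt-hits {μ} (ks , distinct , ok , cover , _) C C⊆P =
    selected C ks , AllPairsP.filter⁺ (inside? C) distinct ,
    All.map (λ ((h , _) , w) → h , w) (selected-All C ok) ,
    (λ κ h w → selected-Any μ C ks w (cover κ h (λ x x∈ → C⊆P x (w x x∈)))) ,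
    length-selected C ks

  Cnt-extend-hits : ∀ {μ k n} {S₀ : Str L (Fin k)} {S : Str L (Fin n)} {ι : Fin k → Fin n} → Inj ι →
    (∀ κ → Holds S₀ κ ⟺ Holds S (mapKey ι κ)) →
    (new : List (Key (Fin n))) → AllPairs (λ κ l → ¬ Same μ κ l) new →
    All (λ κ → ¬ Within (Image ι) κ) new →
    All (Holds S) new →
    (∀ κ → Holds S κ → Within (Image ι) κ ⊎ Any (Same μ κ) new) →
    ∀ C {m} → Cnt μ S₀ ⟦ C ∘ ι ⟧ m → Cnt μ S ⟦ C ⟧ (m + hits C new)
  Cnt-extend-hits {μ} {S = S} {ι} inj iff new distinct outside holds either C {m} cnt =
    subst (λ l → Cnt μ S ⟦ C ⟧ (m + l)) (length-selected C new)
      (Cnt-extend inj iff (selected C new) (AllPairsP.filter⁺ (inside? C) distinct)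
        (AllP.filter⁺ (inside? C) outside) (selected-All C holds) either′ cnt)
    where
    either′ : ∀ κ → Holds S κ → Within ⟦ C ⟧ κ → Within (Image ι) κ ⊎ Any (Same μ κ) (selected C new)
    either′ κ h w with either κ h
    ... | inj₁ im = inj₁ im
    ... | inj₂ s = inj₂ (selected-Any μ C new w s)

  Good : Mode → ∀ {X} → Key X → Set
  Good gen κ = ⊤
  Good sym (i , t) = InjTuple L t

  module Placed (μ : Mode) {k n} (S₀ : Str L (Fin k)) (tame₀ : Tame μ S₀) {ι : Fin k → Fin n} (ι-inj : Inj ι)
    (new : List (Key (Fin n))) (distinct : AllPairs (λ κ l → ¬ Same μ κ l) new)
    (outside : All (λ κ → ¬ Within (Image ι) κ) new) (good : All (Good μ) new) where

    -- Closing `new` under `Same` adds nothing in mode `gen`; in mode `sym` it adds the reorderings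
    -- of a tuple, as a symmetric relation must contain them.
    T : Str L (Fin n)
    T = record { R = λ i t → (∃ λ u → t ≡ map ι u × R S₀ i u) ⊎ Any (λ κ → Same μ κ (i , t)) new }

    T-Tame : Tame μ T
    T-Tame = go μ tame₀ good
      where
      T′ : Mode → Str L (Fin n)
      T′ ν = record { R = λ i t → (∃ λ u → t ≡ map ι u × R S₀ i u) ⊎ Any (λ κ → Same ν κ (i , t)) new }
      go : ∀ ν → Tame ν S₀ → All (Good ν) new → Tame ν (T′ ν)
      go gen _ _ = tt
      go sym (inj₀ , symm₀) good = injective , symmetric
        where
        fromNew : ∀ i t {ks} → All (Good sym) ks → Any (λ κ → Same sym κ (i , t)) ks → InjTuple L t
        fromNew i t {(_ , u) ∷ _} (g ∷ _) (here (refl , s)) = InjTuple-resp L u t (λ x → proj₁ (s x)) g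
        fromNew i t (_ ∷ gs) (there a) = fromNew i t gs a
        injective : ∀ i t → R (T′ sym) i t → InjTuple L t
        injective i t (inj₁ (u , refl , h)) = InjTuple-map⁺ ι-inj u (inj₀ i u h)
        injective i t (inj₂ a) = fromNew i t good a
        symmetric : ∀ i t u → (∀ x → x ∈ᵥ t ⟺ x ∈ᵥ u) → R (T′ sym) i t → R (T′ sym) i u
        symmetric i t u s (inj₂ a) = inj₂ (Any.map (λ e → Same-trans sym e (refl , s)) a)
        symmetric i t u s (inj₁ (t₀ , refl , h)) with unmap ι u (λ x x∈ → image (proj₂ (s x) x∈))
          where
          image : ∀ {x} → x ∈ᵥ map ι t₀ → Image ι x
          image x∈ with ∈ᵥ-map⁻ ι x∈
          ... | y , _ , e = y , ≡-sym e
        ... | u₀ , refl = inj₁ (u₀ , refl , symm₀ i t₀ u₀ (proj₂ (Same-map⁻ sym ι-inj {i , t₀} {i , u₀} (refl , s))) h)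

    -- A new fact on transported points would lie within the image of `ι`, against `outside`; hence
    -- `T` induces on the image nothing beyond `S₀`.
    T-old : ∀ κ → Holds S₀ κ ⟺ Holds T (mapKey ι κ)
    T-old (i , t) = (λ h → inj₁ (t , refl , h)) , back
      where
      mapped : Within (Image ι) (i , map ι t)
      mapped x x∈ with ∈ᵥ-map⁻ ι x∈
      ... | y , _ , e = y , ≡-sym e
      impossible : ∀ {ks} → All (λ κ → ¬ Within (Image ι) κ) ks → ¬ Any (λ κ → Same μ κ (i , map ι t)) ks
      impossible (out ∷ _) (here s) = out (Same-Within μ s mapped)
      impossible (_ ∷ outs) (there a) = impossible outs a
      back : Holds T (i , map ι t) → R S₀ i t
      back (inj₁ (u , e , h)) = subst (R S₀ i) (≡-sym (map-injective ι-inj t u e)) h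
      back (inj₂ a) = ⊥-elim (impossible outside a)

    T-new : All (Holds T) new
    T-new = All.tabulate (λ {κ} κ∈ → inj₂ (Any.map (λ { refl → Same-refl μ κ }) κ∈))

    T-either : ∀ κ → Holds T κ → Within (Image ι) κ ⊎ Any (Same μ κ) new
    T-either (i , t) (inj₂ a) = inj₂ (Any.map (Same-sym μ) a)
    T-either (i , t) (inj₁ (u , refl , _)) = inj₁ mapped
      where
      mapped : Within (Image ι) (i , map ι u)
      mapped x x∈ with ∈ᵥ-map⁻ ι x∈
      ... | y , _ , e = y , ≡-sym e

    T-Cnt : ∀ C {m} → Cnt μ S₀ ⟦ C ∘ ι ⟧ m → Cnt μ T ⟦ C ⟧ (m + hits C new)
    T-Cnt = Cnt-extend-hits ι-inj T-old new distinct outside T-new T-either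

-- Self-sufficient sets in generic structures

module Finite (L : Lang) (μ : Mode) {X : Set} {M : Str L X} (cls : InClass L μ M) where
  open Lang L
  open Counting L
  open Classes L

  δ≥0-all : ∀ A → Unique A → δ≥0 L μ M A
  δ≥0-all = InClass⇒δ≥0 μ cls

  edges : ∀ {k} {a : Fin k → X} → Inj a → Sub k → ℕ
  edges {a = a} inj C = proj₁ (δ≥0-all (elems a C) (elems-unique inj C))

  module _ {k} {a : Fin k → X} (inj : Inj a) where

    edges-FactCount : ∀ C → FactCount L μ M (elems a C) (edges inj C)
    edges-FactCount C = proj₁ (proj₂ (δ≥0-all (elems a C) (elems-unique inj C)))

    edges≤size : ∀ C → edges inj C ≤ size C
    edges≤size C = ≤-trans (proj₂ (proj₂ (δ≥0-all (elems a C) (elems-unique inj C)))) (≤-reflexive (length-elems a C))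

    edges-Cnt : ∀ C → Cnt μ (induced M a) ⟦ C ⟧ (edges inj C)
    edges-Cnt C = Cnt-resp (∈-elems⇔ inj C) (Cnt-pull inj image (FactCount⇒Cnt (edges-FactCount C)))
      where
      image : ∀ x → x ∈ elems a C → Image a x
      image x x∈ with ∈-elems⁻ a C x∈
      ... | p , _ , e = p , e

    edges-mono : Mono (edges inj)
    edges-mono C⊑D = Cnt-mono (edges-Cnt _) (edges-Cnt _) (λ κ h w → h , λ x x∈ → C⊑D x (w x x∈))

    -- The values of `edges` come from unrelated enumerations, one for each subset. Uniqueness of
    -- counts ties them all to the enumeration of the full set, so that counts of different subsets
    -- can be compared key by key.
    edges-hits : ∃ λ ks → ∀ C → edges inj C ≡ hits C ks
    edges-hits = proj₁ all , λ C → Cnt-unique (edges-Cnt C) (Cnt-hits all C (λ _ _ → refl))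
      where
      all : Cnt μ (induced M a) ⟦ (λ _ → true) ⟧ (edges inj (λ _ → true))
      all = edges-Cnt (λ _ → true)

    -- A key inside one of the sets is inside the union, and a key inside both is also inside the
    -- intersection.
    edges-submodular : ∀ C D → edges inj C + edges inj D ≤ edges inj (λ v → C v ∨ D v) + edges inj (λ v → C v ∧ D v)
    edges-submodular C D with edges-hits
    ... | ks , eq rewrite eq C | eq D | eq (λ v → C v ∨ D v) | eq (λ v → C v ∧ D v) = go ks
      where
      pointwise : ∀ {m} (t : Vec (Fin k) m) → 𝟙 (inside C t) + 𝟙 (inside D t) ≤
        𝟙 (inside (λ v → C v ∨ D v) t) + 𝟙 (inside (λ v → C v ∧ D v) t)
      pointwise t with inside C t in eC | inside D t in eD
      ... | false | false = z≤n
      ... | true | false = ≤-trans (𝟙-mono {true} (λ _ → inside-mono (λ v → ∨-⊑ˡ) t eC)) (m≤m+n _ _)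
      ... | false | true = ≤-trans (𝟙-mono {true} (λ _ → inside-mono (λ v → ∨-⊑ʳ {C v}) t eD)) (m≤m+n _ _)
        where
        ∨-⊑ʳ : ∀ {b c} → c ≡ true → b ∨ c ≡ true
        ∨-⊑ʳ {true} _ = refl
        ∨-⊑ʳ {false} e = e
      ... | true | true = +-mono-≤ (𝟙-mono {true} (λ _ → inside-mono (λ v → ∨-⊑ˡ) t eC))
        (𝟙-mono {true} (λ _ → inside⁺ _ t (λ x x∈ → cong₂ _∧_ (inside⁻ C t eC x x∈) (inside⁻ D t eD x x∈))))
      go : ∀ ks → hits C ks + hits D ks ≤ hits (λ v → C v ∨ D v) ks + hits (λ v → C v ∧ D v) ks
      go [] = z≤n
      go (κ ∷ ks) = ≤-trans (≤-reflexive (shuffle (𝟙 (inside C (proj₂ κ))) _ _ _))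
        (≤-trans (+-mono-≤ (pointwise (proj₂ κ)) (go ks))
          (≤-reflexive (shuffle (𝟙 (inside (λ v → C v ∨ D v) (proj₂ κ))) _ _ _)))
        where
        shuffle : ∀ x y z w → (x + y) + (z + w) ≡ (x + z) + (y + w)
        shuffle = solve-∀

    traceCount : ∀ {A} (t : Trace a A) → (∀ x → x ∈ A → Image a x) → FactCount L μ M A (edges inj (Trace.trace t))
    traceCount {A} t A⊆a = Cnt⇒FactCount (Cnt-resp same (FactCount⇒Cnt (edges-FactCount C)))
      where
      open Trace t renaming (trace to C)
      same : ∀ x → x ∈ elems a C ⟺ x ∈ A
      same x = to , from
        where
        to : x ∈ elems a C → x ∈ A
        to x∈ with ∈-elems⁻ a C x∈
        ... | p , e , refl = proj₁ (trace-∈ p) e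
        from : x ∈ A → x ∈ elems a C
        from x∈ with A⊆a x x∈
        ... | p , refl = ∈-elems⁺ a C p (proj₂ (trace-∈ p) x∈)

FactCount-unique : ∀ (L : Lang) {μ X} {S : Str L X} {A m m′} → FactCount L μ S A m → FactCount L μ S A m′ → m ≡ m′
FactCount-unique L c c′ = Counting.Cnt-unique L (Counting.FactCount⇒Cnt L c) (Counting.FactCount⇒Cnt L c′)

∈-tabulateList⁺ : ∀ {k} {X : Set} (a : Fin k → X) p → a p ∈ toList (tabulate a)
∈-tabulateList⁺ a p = ∈V.∈-toList⁺ (∈V.∈-tabulate⁺ a p)

∈-tabulateList⁻ : ∀ {k} {X : Set} (a : Fin k → X) {x} → x ∈ toList (tabulate a) → ∃ λ p → a p ≡ x
∈-tabulateList⁻ a x∈ with ∈-tabulate⁻ a (∈V.∈-toList⁻ x∈)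
... | p , e = p , ≡-sym e

module Generic (L : Lang) (μ : Mode) {X : Set} {M : Str L X} (G : IsGeneric L μ M) where
  open Lang L
  open Counting L
  open Classes L

  cls : InClass L μ M
  cls = proj₁ G

  open Finite L μ {M = M} cls public

  SS : ∀ {k} → (Fin k → X) → Set
  SS a = SSinf L μ M (toList (tabulate a))

  -- What is kept of an extension is its count function `b-edges`: dimensions depend on nothing
  -- else, and the structure itself can be forgotten.
  record Over {k} {a : Fin k → X} (inj : Inj a) {n} (ι : Fin k → Fin n) (new : List (Key (Fin n))) : Set where
    field
      b : Fin n → X
      b-inj : Inj b
      b-ss : SS b
      b-ι : ∀ p → b (ι p) ≡ a p
      b-edges : ∀ C → edges b-inj C ≡ edges inj (C ∘ ι) + hits C new

  module _ {k} {a : Fin k → X} (inj : Inj a) (ss : SS a) where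

    abstract
      -- The extension property applied to `Placed.T`. The first inequality puts `T` into the class.
      -- The second is the self-sufficiency of `ι` in `T` after the facts inside `ι` have been
      -- cancelled, which is possible because the sets tested contain all of `ι`.
      realise : ∀ {n} {ι : Fin k → Fin n} → Inj ι → (new : List (Key (Fin n))) →
        AllPairs (λ κ l → ¬ Same μ κ l) new → All (λ κ → ¬ Within (Image ι) κ) new → All (Good μ) new →
        (∀ C → edges inj (C ∘ ι) + hits C new ≤ size C) →
        (∀ C → (∀ p → C (ι p) ≡ true) → k + hits C new ≤ size C) →
        Over inj ι new
      realise {n} {ι} ι-inj new distinct outside good bound self-sufficient =
        record { b = g ; b-inj = g-inj ; b-ss = proj₂ (proj₂ (proj₂ result)) ; b-ι = g-ι ; b-edges = g-edges }
        where
        open Placed μ (induced M a) (induced-Tame μ a (InClass⇒Tame μ cls)) ι-inj new distinct outside good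

        T-count : ∀ C → Cnt μ T ⟦ C ⟧ (edges inj (C ∘ ι) + hits C new)
        T-count C = T-Cnt C (edges-Cnt inj (C ∘ ι))

        module _ (A : List (Fin n)) where
          t : Trace id A
          t = traceOf {a = id} (λ _ _ e → e) A (λ x _ → x , refl)
          open Trace t public
          A-count : FactCount L μ T A (edges inj (trace ∘ ι) + hits trace new)
          A-count = Cnt⇒FactCount (Cnt-resp trace-∈ (T-count trace))

        T-class : InClass L μ T
        T-class = toInClass μ T-Tame (λ A u → _ , A-count A , ≤-trans (bound (trace A)) (≤-reflexive (trace-size A u)))

        T-ss : SSfin L μ T (toList (tabulate ι)) (List.allFin n)
        T-ss B u ι⊆B _ m m′ c c′ = begin
          length (toList (tabulate ι)) + m′
            ≡⟨ cong₂ _+_ (Vec.length-toList (tabulate ι)) (FactCount-unique L c′ (A-count B)) ⟩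
          k + (edges inj (trace B ∘ ι) + hits (trace B) new)
            ≤⟨ ≤-by (+-mono-≤ (self-sufficient (trace B) full) old≤)
                    (≤-reflexive (ring k (edges inj (trace B ∘ ι)) (hits (trace B) new) (size (trace B)) m)) ⟩
          size (trace B) + m
            ≡⟨ cong (_+ m) (trace-size B u) ⟩
          length B + m ∎
          where
          open ≤-Reasoning
          full : ∀ p → trace B (ι p) ≡ true
          full p = proj₂ (trace-∈ B (ι p)) (ι⊆B (ι p) (∈-tabulateList⁺ ι p))
          A : List (Fin n)
          A = toList (tabulate ι)
          old≤ : edges inj (trace B ∘ ι) ≤ m
          old≤ = begin
            edges inj (trace B ∘ ι) ≤⟨ edges-mono inj (λ p _ → proj₂ (trace-∈ A (ι p)) (∈-tabulateList⁺ ι p)) ⟩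
            edges inj (trace A ∘ ι) ≤⟨ m≤m+n _ _ ⟩
            edges inj (trace A ∘ ι) + hits (trace A) new ≡⟨ FactCount-unique L (A-count A) c ⟩
            m ∎
          ring : ∀ k e h s m → k + (e + h) + (s + m) ≡ s + m + (k + h + e)
          ring = solve-∀

        map-lookup : ∀ {m} (u : Vec (Fin k) m) → map (lookup (tabulate a)) u ≡ map a u
        map-lookup = Vec.map-cong (Vec.lookup∘tabulate a)

        result : Σ (Fin n → X) λ g → IsEmbedding L T M g × (∀ p → g (ι p) ≡ lookup (tabulate a) p) × SSinf L μ M (toList (tabulate g))
        result = proj₂ (proj₂ G) k (tabulate a)
          (λ p q e → inj p q (trans (≡-sym (Vec.lookup∘tabulate a p)) (trans e (Vec.lookup∘tabulate a q))))
          ss n T T-class ι ι-inj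
          (λ i u → (λ h → proj₁ (T-old (i , u)) (subst (R M i) (map-lookup u) h)) ,
                   (λ h → subst (R M i) (≡-sym (map-lookup u)) (proj₂ (T-old (i , u)) h)))
          T-ss

        g : Fin n → X
        g = proj₁ result
        g-inj : Inj g
        g-inj = proj₁ (proj₁ (proj₂ result))
        g-ι : ∀ p → g (ι p) ≡ a p
        g-ι p = trans (proj₁ (proj₂ (proj₂ result)) p) (Vec.lookup∘tabulate a p)
        g-holds : ∀ κ → Holds T κ ⟺ Holds (induced M g) κ
        g-holds (i , u) = proj₂ (proj₁ (proj₂ result)) i u
        g-edges : ∀ C → edges g-inj C ≡ edges inj (C ∘ ι) + hits C new
        g-edges C = ≤-antisym
          (Cnt-mono (edges-Cnt g-inj C) (T-count C) (λ κ h w → proj₂ (g-holds κ) h , w))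
          (Cnt-mono (T-count C) (edges-Cnt g-inj C) (λ κ h w → proj₁ (g-holds κ) h , w))

  -- The stages of the chain are self-sufficient in the whole structure

  chain : ℕ → List X
  chain = proj₁ (proj₁ (proj₂ G))

  chain-unique : ∀ s → Unique (chain s)
  chain-unique = proj₁ (proj₂ (proj₁ (proj₂ G)))

  chain-suc : ∀ s x → x ∈ chain s → x ∈ chain (suc s)
  chain-suc = proj₁ (proj₂ (proj₂ (proj₁ (proj₂ G))))

  chain-ss : ∀ s → SSfin L μ M (chain s) (chain (suc s))
  chain-ss = proj₁ (proj₂ (proj₂ (proj₂ (proj₁ (proj₂ G)))))

  chain-exhausts : ∀ x → Σ ℕ λ s → x ∈ chain s
  chain-exhausts = proj₂ (proj₂ (proj₂ (proj₂ (proj₁ (proj₂ G)))))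

  chain-mono : ∀ {s t} → s ≤ t → ∀ x → x ∈ chain s → x ∈ chain t
  chain-mono {s} s≤t x x∈ = go (≤⇒≤′ s≤t)
    where
    go : ∀ {t} → s ≤′ t → x ∈ chain t
    go ≤′-refl = x∈
    go (≤′-step p) = chain-suc _ x (go p)

  chain-bound : ∀ s {k} (a : Fin k → X) → Σ ℕ λ t → s ≤ t × (∀ p → a p ∈ chain t)
  chain-bound s {zero} a = s , ≤-refl , λ ()
  chain-bound s {suc k} a with chain-exhausts (a zero) | chain-bound s (a ∘ suc)
  ... | t , a₀∈ | u , s≤u , all = t ⊔ u , ≤-trans s≤u (m≤n⊔m t u) ,
    λ { zero → chain-mono (m≤m⊔n t u) _ a₀∈ ; (suc p) → chain-mono (m≤n⊔m t u) _ (all p) }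

  ∈⇒lookup : ∀ {A : List X} {x} → x ∈ A → Image (List.lookup A) x
  ∈⇒lookup x∈ = Any.index x∈ , ≡-sym (AnyP.lookup-index x∈)

  lookup-inj : ∀ {A : List X} → Unique A → Inj (List.lookup A)
  lookup-inj u p q e with Fin.<-cmp p q
  ... | tri< p<q _ _ = contradiction e (AllPairs-lookup u p<q)
  ... | tri≈ _ p≡q _ = p≡q
  ... | tri> _ _ q<p = contradiction (≡-sym e) (AllPairs-lookup u q<p)

  -- The hypothesis on U = `chain s` speaks only of supersets of U inside the next stage.
  -- Submodularity turns δ(U) ≤ δ(U ∪ C) into δ(U ∩ C) ≤ δ(C) for arbitrary C in that stage.
  chain-step : ∀ s {C D} → Unique C → Unique D → (∀ x → x ∈ C → x ∈ chain (suc s)) →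
    (∀ x → x ∈ D ⟺ (x ∈ C × x ∈ chain s)) → δ≤δ L μ M D C
  chain-step s {C} {D} C! D! C⊆ D⟺ m m′ cD cC = begin
    length D + m′ ≡⟨ cong₂ _+_ (≡-sym D-size) (FactCount-unique L cC (traceCount a-inj tC inC)) ⟩
    size (λ v → u v ∧ c v) + e c ≤⟨ ≤-by (+-mono-≤ ss (+-mono-≤ (edges-submodular a-inj u c) (≤-reflexive sizes)))
        (≤-reflexive (ring (size (λ v → u v ∧ c v)) (e c) (size u) (e (λ v → u v ∨ c v)) (size (λ v → u v ∨ c v)) (e u) (e (λ v → u v ∧ c v)) (size c))) ⟩
    size c + e (λ v → u v ∧ c v) ≡⟨ cong₂ _+_ (Trace.trace-size tC C!) (FactCount-unique L D-count cD) ⟩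
    length C + m ∎
    where
    open ≤-Reasoning
    a : Fin (length (chain (suc s))) → X
    a = List.lookup (chain (suc s))
    a-inj : Inj a
    a-inj = lookup-inj (chain-unique (suc s))
    e : Sub _ → ℕ
    e = edges a-inj
    inU : ∀ x → x ∈ chain s → Image a x
    inU x x∈ = ∈⇒lookup (chain-suc s x x∈)
    inC : ∀ x → x ∈ C → Image a x
    inC x x∈ = ∈⇒lookup (C⊆ x x∈)
    inD : ∀ x → x ∈ D → Image a x
    inD x x∈ = inC x (proj₁ (proj₁ (D⟺ x) x∈))
    tU : Trace a (chain s)
    tU = traceOf a-inj (chain s) inU
    tC : Trace a C
    tC = traceOf a-inj C inC
    u c : Sub _
    u = Trace.trace tU
    c = Trace.trace tC
    ∈D : ∀ p → u p ∧ c p ≡ true ⟺ a p ∈ D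
    ∈D p = (λ h → proj₂ (D⟺ (a p)) (proj₁ (Trace.trace-∈ tC p) (proj₂ (∧-true {u p} h)) , proj₁ (Trace.trace-∈ tU p) (proj₁ (∧-true h)))) ,
           (λ h → cong₂ _∧_ (proj₂ (Trace.trace-∈ tU p) (proj₂ (proj₁ (D⟺ (a p)) h))) (proj₂ (Trace.trace-∈ tC p) (proj₁ (proj₁ (D⟺ (a p)) h))))
    D-trace : Trace a D
    D-trace = record { trace = λ v → u v ∧ c v ; trace-∈ = ∈D ; trace-size = sz }
      where
      t₀ : Trace a D
      t₀ = traceOf a-inj D inD
      sz : Unique D → size (λ v → u v ∧ c v) ≡ length D
      sz D! = trans (≤-antisym
        (size-mono (λ v → proj₂ (Trace.trace-∈ t₀ v) ∘ proj₁ (∈D v)))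
        (size-mono (λ v → proj₂ (∈D v) ∘ proj₁ (Trace.trace-∈ t₀ v)))) (Trace.trace-size t₀ D!)
    D-size : size (λ v → u v ∧ c v) ≡ length D
    D-size = Trace.trace-size D-trace D!
    D-count : FactCount L μ M D (e (λ v → u v ∧ c v))
    D-count = traceCount a-inj D-trace inD
    B : List X
    B = elems a (λ v → u v ∨ c v)
    ss : size u + e (λ v → u v ∨ c v) ≤ size (λ v → u v ∨ c v) + e u
    ss = subst₂ (λ x y → x + e (λ v → u v ∨ c v) ≤ y + e u) (≡-sym (Trace.trace-size tU (chain-unique s))) (length-elems a _)
      (chain-ss s B (elems-unique a-inj _) U⊆B B⊆ (e u) (e (λ v → u v ∨ c v)) (traceCount a-inj tU inU) (edges-FactCount a-inj _))
      where
      U⊆B : ∀ x → x ∈ chain s → x ∈ B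
      U⊆B x x∈ with inU x x∈
      ... | p , refl = ∈-elems⁺ a _ p (∨-⊑ˡ (proj₂ (Trace.trace-∈ tU p) x∈))
      B⊆ : ∀ x → x ∈ B → x ∈ chain (suc s)
      B⊆ x x∈ with ∈-elems⁻ a _ x∈
      ... | p , _ , refl = ∈P.∈-lookup p
    sizes : size (λ v → u v ∨ c v) + size (λ v → u v ∧ c v) ≡ size u + size c
    sizes = trans (≡-sym (∑-distrib-+ (λ v → 𝟙 (u v ∨ c v)) (λ v → 𝟙 (u v ∧ c v))))
      (trans (sum-cong-≗ (λ v → pointwise (u v) (c v))) (∑-distrib-+ (𝟙 ∘ u) (𝟙 ∘ c)))
      where
      pointwise : ∀ b d → 𝟙 (b ∨ d) + 𝟙 (b ∧ d) ≡ 𝟙 b + 𝟙 d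
      pointwise true d = refl
      pointwise false d = +-identityʳ _
    ring : ∀ i ec su eo so eu ei sc →
      i + ec + ((so + eu) + ((eo + ei) + (su + sc))) ≡ sc + ei + ((su + eo) + ((eu + ec) + (so + i)))
    ring = solve-∀

  -- Descent by one stage at a time: `chain-step` compares C with its part E in the stage below, and
  -- the induction compares E with D. At `d = 0` the sets C and D have the same elements.
  chain-below : ∀ d s {C D} → Unique C → Unique D → (∀ x → x ∈ C → x ∈ chain (d + s)) →
    (∀ x → x ∈ D ⟺ (x ∈ C × x ∈ chain s)) → δ≤δ L μ M D C
  chain-below zero s {C} {D} C! D! C⊆ D⟺ m m′ cD cC = +-mono-≤
    (Unique-⊆-length D! (λ x x∈ → proj₁ (proj₁ (D⟺ x) x∈)))
    (Cnt-mono (FactCount⇒Cnt cC) (FactCount⇒Cnt cD) (λ κ h w → h , λ x x∈ → proj₂ (D⟺ x) (w x x∈ , C⊆ x (w x x∈))))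
  chain-below (suc d) s {C} {D} C! D! C⊆ D⟺ m m′ cD cC =
    ≤-by (+-mono-≤ (chain-below d s E! D! E⊆ D⟺E m l cD cE) (chain-step (d + s) C! E! C⊆ E⟺ l m′ cE cC))
         (≤-reflexive (ring (length D) m′ (length E) l (length C) m))
    where
    a : Fin (length (chain (suc d + s))) → X
    a = List.lookup (chain (suc d + s))
    a-inj : Inj a
    a-inj = lookup-inj (chain-unique (suc d + s))
    tU : Trace a (chain (d + s))
    tU = traceOf a-inj (chain (d + s)) (λ x x∈ → ∈⇒lookup (chain-suc _ x x∈))
    tC : Trace a C
    tC = traceOf a-inj C (λ x x∈ → ∈⇒lookup (C⊆ x x∈))
    W : Sub _
    W v = Trace.trace tC v ∧ Trace.trace tU v
    E : List X
    E = elems a W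
    E! : Unique E
    E! = elems-unique a-inj W
    E⟺ : ∀ x → x ∈ E ⟺ (x ∈ C × x ∈ chain (d + s))
    E⟺ x = to , from
      where
      to : x ∈ E → x ∈ C × x ∈ chain (d + s)
      to x∈ with ∈-elems⁻ a W x∈
      ... | p , e , refl = proj₁ (Trace.trace-∈ tC p) (proj₁ (∧-true e)) ,
                           proj₁ (Trace.trace-∈ tU p) (proj₂ (∧-true {Trace.trace tC p} e))
      from : x ∈ C × x ∈ chain (d + s) → x ∈ E
      from (x∈C , x∈U) with ∈⇒lookup (C⊆ x x∈C)
      ... | p , refl = ∈-elems⁺ a W p (cong₂ _∧_ (proj₂ (Trace.trace-∈ tC p) x∈C) (proj₂ (Trace.trace-∈ tU p) x∈U))
    E⊆ : ∀ x → x ∈ E → x ∈ chain (d + s)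
    E⊆ x x∈ = proj₂ (proj₁ (E⟺ x) x∈)
    D⟺E : ∀ x → x ∈ D ⟺ (x ∈ E × x ∈ chain s)
    D⟺E x = (λ x∈ → let x∈C , x∈s = proj₁ (D⟺ x) x∈ in
                     proj₂ (E⟺ x) (x∈C , chain-mono (m≤n+m s d) x x∈s) , x∈s) ,
            (λ (x∈E , x∈s) → proj₂ (D⟺ x) (proj₁ (proj₁ (E⟺ x) x∈E) , x∈s))
    l : ℕ
    l = proj₁ (δ≥0-all E E!)
    cE : FactCount L μ M E l
    cE = proj₁ (proj₂ (δ≥0-all E E!))
    ring : ∀ d m′ e l c m → d + m′ + ((e + m) + (c + l)) ≡ c + m + ((d + l) + (e + m′))
    ring = solve-∀

  chain-SSinf : ∀ s → SSinf L μ M (chain s)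
  chain-SSinf s C C! D D! D⟺ with chain-bound s (List.lookup C)
  ... | t , s≤t , all = chain-below (t ∸ s) s C! D! C⊆ D⟺
    where
    C⊆ : ∀ x → x ∈ C → x ∈ chain (t ∸ s + s)
    C⊆ x x∈ with ∈⇒lookup x∈
    ... | p , refl = subst (λ t → List.lookup C p ∈ chain t) (≡-sym (m∸n+n≡m s≤t)) (all p)

  SSinf-resp : ∀ {A B} → (∀ x → x ∈ A ⟺ x ∈ B) → SSinf L μ M A → SSinf L μ M B
  SSinf-resp A⟺B ss C C! D D! D⟺ = ss C C! D D! (λ x →
    (λ x∈ → let x∈C , x∈B = proj₁ (D⟺ x) x∈ in x∈C , proj₂ (A⟺B x) x∈B) ,
    (λ (x∈C , x∈A) → proj₂ (D⟺ x) (x∈C , proj₁ (A⟺B x) x∈A)))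

  -- For the empty set, self-sufficiency is the class condition δ(C) ≥ 0.
  empty-SS : ∀ {a : Fin 0 → X} → SS a
  empty-SS C C! D D! D⟺ m m′ cD cC = ≤-trans (+-mono-≤ no-vertices bounded) (m≤m+n (length C) m)
    where
    no-vertices : length D ≤ 0
    no-vertices = Unique-⊆-length D! (λ x x∈ → proj₂ (proj₁ (D⟺ x) x∈))
    bounded : m′ ≤ length C
    bounded = subst (_≤ length C) (FactCount-unique L (proj₁ (proj₂ (δ≥0-all C C!))) cC) (proj₂ (proj₂ (δ≥0-all C C!)))

  -- The fields `distinct`, `outside` and `self-sufficient` are shaped as hypotheses of `realise` in
  -- the other structure. In particular, `self-sufficient` speaks of `k` and `new` alone and not of
  -- the facts on `a`, which differ between the two sides.
  record Enlargement {k} {a : Fin k → X} (inj : Inj a) (s : ℕ) : Set where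
    field
      {n} : ℕ
      ι : Fin k → Fin n
      ι-inj : Inj ι
      new : List (Key (Fin n))
      distinct : AllPairs (λ κ l → ¬ Same μ κ l) new
      outside : All (λ κ → ¬ Within (Image ι) κ) new
      over : Over inj ι new
      self-sufficient : ∀ C → (∀ p → C (ι p) ≡ true) → k + hits C new ≤ size C
      covers : ∀ x → x ∈ chain s → Image (Over.b over) x

  abstract
    enlarge : ∀ {k} {a : Fin k → X} (inj : Inj a) → SS a → ∀ s → Enlargement inj s
    enlarge {k} {a} inj ss s with chain-bound s a
    ... | t , s≤t , all = record
      { ι = ι ; ι-inj = ι-inj ; new = new ; distinct = new-distinct ; outside = new-outside
      ; over = record { b = b ; b-inj = b-inj ; b-ss = b-ss ; b-ι = b-ι ; b-edges = b-edges }
      ; self-sufficient = self-sufficient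
      ; covers = λ x x∈ → ∈⇒lookup (chain-mono s≤t x x∈) }
      where
      n : ℕ
      n = length (chain t)
      b : Fin n → X
      b = List.lookup (chain t)
      b-inj : Inj b
      b-inj = lookup-inj (chain-unique t)
      b-ss : SS b
      b-ss = SSinf-resp (λ x → (λ x∈ → listed (∈⇒lookup x∈)) , (λ x∈ → unlisted (∈-tabulateList⁻ b x∈))) (chain-SSinf t)
        where
        listed : ∀ {x} → Image b x → x ∈ toList (tabulate b)
        listed (p , refl) = ∈-tabulateList⁺ b p
        unlisted : ∀ {x} → Image b x → x ∈ chain t
        unlisted (p , refl) = ∈P.∈-lookup p
      ι : Fin k → Fin n
      ι p = Any.index (all p)
      b-ι : ∀ p → b (ι p) ≡ a p
      b-ι p = ≡-sym (AnyP.lookup-index (all p))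
      ι-inj : Inj ι
      ι-inj p q e = inj p q (trans (≡-sym (b-ι p)) (trans (cong b e) (b-ι q)))
      S : Str L (Fin n)
      S = induced M b
      image? : ∀ v → Dec (Image ι v)
      image? v = Fin.any? (λ p → ι p Fin.≟ v)
      im : Sub n
      im v = does (image? v)
      im⁻ : ∀ v → im v ≡ true → Image ι v
      im⁻ v e with image? v
      ... | yes h = h
      im⁺ : ∀ v → Image ι v → im v ≡ true
      im⁺ v h with image? v
      ... | yes _ = refl
      ... | no ¬h = contradiction h ¬h
      within? : ∀ κ → Dec (Within (Image ι) κ)
      within? (i , u) with inside im u Bool.≟ true
      ... | yes e = yes (λ x x∈ → im⁻ x (inside⁻ im u e x x∈))
      ... | no ne = no (λ w → ne (inside⁺ im u (λ x x∈ → im⁺ x (w x x∈))))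
      total : Cnt μ S ⟦ (λ _ → true) ⟧ (edges b-inj (λ _ → true))
      total = edges-Cnt b-inj (λ _ → true)
      outside? : ∀ κ → Dec (¬ Within (Image ι) κ)
      outside? κ = ¬? (within? κ)
      new : List (Key (Fin n))
      new = List.filter outside? (proj₁ total)
      new-distinct : AllPairs (λ κ l → ¬ Same μ κ l) new
      new-distinct = AllPairsP.filter⁺ outside? (proj₁ (proj₂ total))
      new-outside : All (λ κ → ¬ Within (Image ι) κ) new
      new-outside = AllP.all-filter outside? (proj₁ total)
      new-holds : All (Holds S) new
      new-holds = AllP.filter⁺ outside? (All.map proj₁ (proj₁ (proj₂ (proj₂ total))))
      either : ∀ κ → Holds S κ → Within (Image ι) κ ⊎ Any (Same μ κ) new
      either κ h with within? κ
      ... | yes w = inj₁ w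
      ... | no ¬w with AnyP.filter⁺ outside? (proj₁ (proj₂ (proj₂ (proj₂ total))) κ h (λ _ _ → refl))
      ...   | inj₁ s = inj₂ s
      ...   | inj₂ ¬¬w = contradiction
        (λ w → ¬w (Same-Within μ (AnyP.lookup-result (proj₁ (proj₂ (proj₂ (proj₂ total))) κ h (λ _ _ → refl))) w)) ¬¬w
      map-b-ι : ∀ {m} (u : Vec (Fin k) m) → map b (map ι u) ≡ map a u
      map-b-ι u = trans (≡-sym (Vec.map-∘ b ι u)) (Vec.map-cong b-ι u)
      iff : ∀ κ → Holds (induced M a) κ ⟺ Holds S (mapKey ι κ)
      iff (i , u) = subst (R M i) (≡-sym (map-b-ι u)) , subst (R M i) (map-b-ι u)
      b-edges : ∀ C → edges b-inj C ≡ edges inj (C ∘ ι) + hits C new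
      b-edges C = Cnt-unique (edges-Cnt b-inj C)
        (Cnt-extend-hits ι-inj iff new new-distinct new-outside new-holds either C (edges-Cnt inj (C ∘ ι)))
      full : Sub k
      full _ = true
      -- The self-sufficiency of `a` is tested on `elems b C`. As `C` contains the image of `ι`, all
      -- facts on `a` appear on both sides and cancel.
      self-sufficient : ∀ C → (∀ p → C (ι p) ≡ true) → k + hits C new ≤ size C
      self-sufficient C C⊇ = ≤-by (+-mono-≤ relative (edges-mono inj {full} {C ∘ ι} (λ p _ → C⊇ p)))
        (≤-reflexive (ring k (hits C new) (size C) (edges inj full) (edges inj (C ∘ ι))))
        where
        D⟺ : ∀ x → x ∈ elems a full ⟺ (x ∈ elems b C × x ∈ toList (tabulate a))
        D⟺ x = to , from
          where
          to : x ∈ elems a full → x ∈ elems b C × x ∈ toList (tabulate a)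
          to x∈ with ∈-elems⁻ a full x∈
          ... | p , _ , refl = subst (_∈ elems b C) (b-ι p) (∈-elems⁺ b C (ι p) (C⊇ p)) , ∈-tabulateList⁺ a p
          from : x ∈ elems b C × x ∈ toList (tabulate a) → x ∈ elems a full
          from (_ , x∈) with ∈-tabulateList⁻ a x∈
          ... | p , refl = ∈-elems⁺ a full p refl
        relative : k + (edges inj (C ∘ ι) + hits C new) ≤ size C + edges inj full
        relative = begin
          k + (edges inj (C ∘ ι) + hits C new) ≡⟨ cong₂ _+_ (trans (length-elems a full) (size-full {C = full} (λ _ → refl))) (b-edges C) ⟨
          length (elems a full) + edges b-inj C ≤⟨ ss (elems b C) (elems-unique b-inj C) (elems a full) (elems-unique inj full) D⟺ _ _ (edges-FactCount inj full) (edges-FactCount b-inj C) ⟩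
          length (elems b C) + edges inj full  ≡⟨ cong (_+ edges inj full) (length-elems b C) ⟩
          size C + edges inj full              ∎
          where open ≤-Reasoning
        ring : ∀ k h s f e → k + h + (s + f + e) ≡ s + (k + (e + h) + f)
        ring = solve-∀

-- Replacing tuples by sets of parallel points

pathEdge-InjTuple : ∀ (L : Lang) {r} (j : Fin (suc r)) → InjTuple L (pathEdge j)
pathEdge-InjTuple L j p q e = Fin.punchIn-injective j p q (Fin.punchIn-injective (inject₁ j) _ _
  (trans (≡-sym (Vec.lookup∘tabulate _ p)) (trans e (Vec.lookup∘tabulate _ q))))

-- Only vertex `zero` of a gadget is old. Position `suc zero` of an edge always holds a fresh
-- vertex, because `punchIn` sends successors to successors; this vertex reveals to which gadget the
-- edge belongs.
pathEdge-new : ∀ {r} → 3 ≤ r → (j : Fin (suc r)) → ∃ λ z → suc z ∈ᵥ pathEdge j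
pathEdge-new (s≤s (s≤s _)) j = proj₁ eq , subst (_∈ᵥ pathEdge j) (proj₂ eq)
  (∈V.∈-tabulate⁺ (λ x → punchIn (inject₁ j) (punchIn j x)) (suc zero))
  where
  punchIn-suc : ∀ {n} (i : Fin (suc (suc n))) x → ∃ λ z → punchIn i (suc x) ≡ suc z
  punchIn-suc zero x = _ , refl
  punchIn-suc (suc i) x = _ , refl
  eq : ∃ λ z → punchIn (inject₁ j) (punchIn j (suc zero)) ≡ suc z
  eq with punchIn j (suc zero) | punchIn-suc j zero
  ... | _ | z , refl = punchIn-suc (inject₁ j) z

≡-by-true : ∀ {b c} → (b ≡ true → c ≡ true) → (c ≡ true → b ≡ true) → b ≡ c
≡-by-true {true} f g = ≡-sym (f refl)
≡-by-true {false} {true} f g = g refl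
≡-by-true {false} {false} f g = refl

module ParallelCopies (L : Lang) {n : ℕ} (fs : List (Counting.Key L (Fin n))) where
  open Lang L
  open Counting L
  open Classes L

  key : Fin (length fs) → Key (Fin n)
  key = List.lookup fs

  -- The sum of the arities serves as a common bound, so that the slots of facts of different
  -- arities form one product of two finite types.
  r width Γ : ℕ
  r = ar nonempty
  width = sum (λ f → ar (proj₁ (key f)))
  Γ = length fs * width

  arity≤width : ∀ f → ar (proj₁ (key f)) ≤ width
  arity≤width = term≤sum (λ f → ar (proj₁ (key f)))

  -- Slots beyond the arity of the fact are unused; they get an arbitrary anchor.
  entry : Key (Fin n) → Fin width → Fin n
  entry (i , t) q with toℕ q <? ar i
  ... | yes q< = lookup t (F.fromℕ< q<)
  ... | no _ = lookup t (F.fromℕ< (≤-trans (s≤s z≤n) (ar≥3 i)))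

  entryAt : Fin (length fs) × Fin width → Fin n
  entryAt (f , q) = entry (key f) q

  anchor : Fin Γ → Fin n
  anchor γ = entryAt (F.remQuot width γ)

  open Gadgets n r Γ (ar≥3 nonempty) anchor public

  slot : ∀ f → Fin (ar (proj₁ (key f))) → Fin Γ
  slot f p = combine f (F.inject≤ p (arity≤width f))

  entry-inject≤ : ∀ i t p (i≤ : ar i ≤ width) → entry (i , t) (F.inject≤ p i≤) ≡ lookup t p
  entry-inject≤ i t p i≤ with toℕ (F.inject≤ p i≤) <? ar i
  ... | yes q< = cong (lookup t) (Fin.toℕ-injective (trans (Fin.toℕ-fromℕ< q<) (Fin.toℕ-inject≤ p _)))
  ... | no ≮ = contradiction (subst (_< ar i) (≡-sym (Fin.toℕ-inject≤ p _)) (Fin.toℕ<n p)) ≮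

  anchor-slot : ∀ f p → anchor (slot f p) ≡ lookup (proj₂ (key f)) p
  anchor-slot f p = trans (cong entryAt (Fin.remQuot-combine f (F.inject≤ p (arity≤width f))))
    (entry-inject≤ (proj₁ (key f)) (proj₂ (key f)) p (arity≤width f))

  copy : ∀ f → Fin (ar (proj₁ (key f))) → Fin N
  copy f p = fresh (slot f p) zero

  copyKey : Fin (length fs) → Key (Fin N)
  copyKey f = proj₁ (key f) , tabulate (copy f)

  copies : List (Key (Fin N))
  copies = List.tabulate copyKey

  gadgetAt : Fin Γ × Fin (suc r) → Key (Fin N)
  gadgetAt (γ , j) = nonempty , map (place γ) (pathEdge j)

  gadgetKey : Fin (Γ * suc r) → Key (Fin N)
  gadgetKey x = gadgetAt (F.remQuot (suc r) x)

  gadgets : List (Key (Fin N))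
  gadgets = List.tabulate gadgetKey

  hits-gadgets : ∀ C → hits C gadgets ≡ gadgetCount C
  hits-gadgets C = begin
    hits C gadgets                                ≡⟨ hits-tabulate C gadgetKey ⟩
    sum (λ x → 𝟙 (inside C (proj₂ (gadgetKey x)))) ≡⟨ sum-combine Γ (suc r) _ ⟩
    sum {Γ} (λ γ → sum {suc r} (λ j → 𝟙 (inside C (proj₂ (gadgetKey (combine γ j))))))
      ≡⟨ sum-cong-≗ (λ γ → sum-cong-≗ (λ j → cong 𝟙 (at γ j))) ⟩
    gadgetCount C ∎
    where
    open ≡-Reasoning
    at : ∀ γ j → inside C (proj₂ (gadgetKey (combine γ j))) ≡ inside (C ∘ place γ) (pathEdge j)
    at γ j = trans (cong (λ x → inside C (proj₂ (gadgetAt x))) (Fin.remQuot-combine γ j)) (inside-map C (place γ) (pathEdge j))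

  -- The copy in `slot f p` and the `p`-th entry of the fact, its anchor, are vertices of one
  -- gadget; a closed set contains both or neither.
  hits-copies : ∀ C → (∀ γ → Closed C γ) → hits C copies ≡ hits (C ∘ old) fs
  hits-copies C closed = begin
    hits C copies                                        ≡⟨ hits-tabulate C copyKey ⟩
    sum (λ f → 𝟙 (inside C (tabulate (copy f))))         ≡⟨ sum-cong-≗ (λ f → cong 𝟙 (≡-by-true (to f) (from f))) ⟩
    sum (λ f → 𝟙 (inside (C ∘ old) (proj₂ (key f))))     ≡⟨ hits-tabulate (C ∘ old) key ⟨
    hits (C ∘ old) (List.tabulate key)                   ≡⟨ cong (hits (C ∘ old)) (List.tabulate-lookup fs) ⟩
    hits (C ∘ old) fs ∎
    where
    open ≡-Reasoning
    within-gadget : ∀ γ v w → C (place γ v) ≡ true → C (place γ w) ≡ true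
    within-gadget γ v w e with closed γ
    ... | inj₁ empty = contradiction (trans (≡-sym e) (empty v)) (λ ())
    ... | inj₂ full = full w
    to : ∀ f → inside C (tabulate (copy f)) ≡ true → inside (C ∘ old) (proj₂ (key f)) ≡ true
    to f e = inside⁺ (C ∘ old) (proj₂ (key f)) λ x x∈ → at (VecAny.index x∈) (VecAnyP.lookup-index x∈)
      where
      at : ∀ p {x} → x ≡ lookup (proj₂ (key f)) p → C (old x) ≡ true
      at p refl = subst (λ v → C (old v) ≡ true) (anchor-slot f p)
        (within-gadget (slot f p) (suc zero) zero (inside⁻ C (tabulate (copy f)) e (copy f p) (∈V.∈-tabulate⁺ (copy f) p)))
    from : ∀ f → inside (C ∘ old) (proj₂ (key f)) ≡ true → inside C (tabulate (copy f)) ≡ true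
    from f e = inside⁺ C (tabulate (copy f)) λ x x∈ → at (∈-tabulate⁻ (copy f) x∈)
      where
      at : ∀ {x} → (∃ λ p → x ≡ copy f p) → C x ≡ true
      at (p , refl) = within-gadget (slot f p) zero (suc zero) (subst (λ v → C (old v) ≡ true) (≡-sym (anchor-slot f p))
        (inside⁻ (C ∘ old) (proj₂ (key f)) e _ (∈V.∈-lookup p (proj₂ (key f)))))

  old-inj : Inj old
  old-inj v w = Fin.↑ˡ-injective _ v w

  old≢fresh : ∀ v γ j → old v ≢ fresh γ j
  old≢fresh v γ j e with trans (≡-sym (Fin.splitAt-↑ˡ n v (Γ * suc r))) (trans (cong (F.splitAt n) e) (Fin.splitAt-↑ʳ n (Γ * suc r) (combine γ j)))
  ... | ()

  fresh-inj : ∀ {γ j γ′ j′} → fresh γ j ≡ fresh γ′ j′ → γ ≡ γ′ × j ≡ j′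
  fresh-inj {γ} {j} {γ′} {j′} e = Fin.combine-injective γ j γ′ j′ (Fin.↑ʳ-injective n _ _ e)

  place-inj : ∀ γ → Inj (place γ)
  place-inj γ zero zero e = refl
  place-inj γ zero (suc q) e = contradiction e (old≢fresh _ γ q)
  place-inj γ (suc p) zero e = contradiction (≡-sym e) (old≢fresh _ γ p)
  place-inj γ (suc p) (suc q) e = cong suc (proj₂ (fresh-inj e))

  fresh-place : ∀ {γ j γ′} v → fresh γ j ≡ place γ′ v → γ ≡ γ′
  fresh-place zero e = contradiction (≡-sym e) (old≢fresh _ _ _)
  fresh-place (suc v) e = proj₁ (fresh-inj e)

  fresh-∈ : ∀ {γ j γ′ m} (t : Vec (Fin (suc (suc r))) m) → fresh γ j ∈ᵥ map (place γ′) t → γ ≡ γ′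
  fresh-∈ {γ′ = γ′} t x∈ with ∈ᵥ-map⁻ (place γ′) x∈
  ... | v , _ , e = fresh-place v e

  -- Proved for `Same sym`, the coarser identification, and therefore available in both modes. A
  -- fresh vertex on the edge determines the gadget, then `pathEdge-injective` determines the edge.
  gadget-distinct : ∀ {x y} → x ≢ y → ¬ Same sym (gadgetKey x) (gadgetKey y)
  gadget-distinct {x} {y} x≢y (_ , s) =
    x≢y (trans (≡-sym (Fin.combine-remQuot {Γ} (suc r) x)) (trans (eq _ _ _ _ s) (Fin.combine-remQuot {Γ} (suc r) y)))
    where
    eq : ∀ γ j γ′ j′ → (∀ v → v ∈ᵥ map (place γ) (pathEdge j) ⟺ v ∈ᵥ map (place γ′) (pathEdge j′)) → combine γ j ≡ combine γ′ j′
    eq γ j γ′ j′ s with pathEdge-new (ar≥3 nonempty) j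
    ... | z , z∈ with fresh-∈ (pathEdge j′) (proj₁ (s _) (∈V.∈-map⁺ (place γ) z∈))
    ... | refl = cong (combine γ) (pathEdge-injective j j′ sub)
      where
      sub : ∀ v → v ∈ᵥ pathEdge j → v ∈ᵥ pathEdge j′
      sub v v∈ with ∈ᵥ-map⁻ (place γ) (proj₁ (s _) (∈V.∈-map⁺ (place γ) v∈))
      ... | w , w∈ , e = subst (_∈ᵥ pathEdge j′) (≡-sym (place-inj γ _ _ e)) w∈

  slot-inj : ∀ {f g p q} → slot f p ≡ slot g q → f ≡ g × toℕ p ≡ toℕ q
  slot-inj {f} {g} {p} {q} e with Fin.combine-injective f (F.inject≤ p (arity≤width f)) g (F.inject≤ q (arity≤width g)) e
  ... | f≡g , p≡q = f≡g , trans (≡-sym (Fin.toℕ-inject≤ p _)) (trans (cong toℕ p≡q) (Fin.toℕ-inject≤ q _))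

  copy-inj : ∀ {f g p q} → copy f p ≡ copy g q → f ≡ g × toℕ p ≡ toℕ q
  copy-inj e = slot-inj (proj₁ (fresh-inj e))

  position : ∀ i j → j < 3 → Fin (ar i)
  position i j j<3 = F.fromℕ< (≤-trans j<3 (ar≥3 i))

  copy-distinct : ∀ {f g} → f ≢ g → ¬ Same sym (copyKey f) (copyKey g)
  copy-distinct {f} {g} f≢g (_ , s)
    with ∈-tabulate⁻ (copy g) (proj₁ (s _) (∈V.∈-tabulate⁺ (copy f) (position _ 0 (s≤s z≤n))))
  ... | q , e = f≢g (proj₁ (copy-inj e))

  -- A gadget edge meets only one gadget, a copied fact at least three.
  copy-gadget-distinct : ∀ f x → ¬ Same sym (copyKey f) (gadgetKey x)
  copy-gadget-distinct f x (_ , s) = contradiction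
    (trans (≡-sym (Fin.toℕ-fromℕ< _)) (trans (proj₂ (slot-inj {f} {f} {p₀} {p₁} (trans (at p₀) (≡-sym (at p₁))))) (Fin.toℕ-fromℕ< _))) λ ()
    where
    p₀ p₁ : Fin (ar (proj₁ (key f)))
    p₀ = position _ 0 (s≤s z≤n)
    p₁ = position _ 1 (s≤s (s≤s z≤n))
    at : ∀ p → slot f p ≡ proj₁ (F.remQuot {Γ} (suc r) x)
    at p = fresh-∈ (pathEdge _) (proj₁ (s _) (∈V.∈-tabulate⁺ (copy f) p))

  gadgets-outside : All (λ κ → ¬ Within (Image old) κ) gadgets
  gadgets-outside = AllP.tabulate⁺ out
    where
    out : ∀ x → ¬ Within (Image old) (gadgetKey x)
    out x w with pathEdge-new (ar≥3 nonempty) (proj₂ (F.remQuot {Γ} (suc r) x))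
    ... | z , z∈ with w _ (∈V.∈-map⁺ (place (proj₁ (F.remQuot {Γ} (suc r) x))) z∈)
    ... | v , e = old≢fresh v _ z e

  copies-outside : All (λ κ → ¬ Within (Image old) κ) copies
  copies-outside = AllP.tabulate⁺ λ f w → let v , e = w _ (∈V.∈-tabulate⁺ (copy f) (position _ 0 (s≤s z≤n))) in old≢fresh v _ zero e

  gadgets-distinct : AllPairs (λ κ l → ¬ Same sym κ l) gadgets
  gadgets-distinct = AllPairsP.tabulate⁺ gadget-distinct

  all-distinct : AllPairs (λ κ l → ¬ Same sym κ l) (copies List.++ gadgets)
  all-distinct = AllPairsP.++⁺ (AllPairsP.tabulate⁺ copy-distinct) gadgets-distinct
    (AllP.tabulate⁺ λ f → AllP.tabulate⁺ (copy-gadget-distinct f))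

  all-good : All (Good sym) (copies List.++ gadgets)
  all-good = AllP.++⁺ (AllP.tabulate⁺ copy-good)
    (AllP.tabulate⁺ λ x → InjTuple-map⁺ (place-inj _) (pathEdge (proj₂ (F.remQuot {Γ} (suc r) x))) (pathEdge-InjTuple L (proj₂ (F.remQuot {Γ} (suc r) x))))
    where
    copy-good : ∀ f → InjTuple L (tabulate (copy f))
    copy-good f p q e = Fin.toℕ-injective (proj₂ (copy-inj {f} {f} {p} {q}
      (trans (≡-sym (Vec.lookup∘tabulate (copy f) p)) (trans e (Vec.lookup∘tabulate (copy f) q)))))

  original replaced : Sub N → ℕ
  original C = hits (C ∘ old) fs + gadgetCount C
  replaced C = hits C copies + gadgetCount C

  original-mono : Mono original
  original-mono C⊑D = +-mono-≤ (hits-mono fs (λ v → C⊑D (old v))) (gadgetCount-mono C⊑D)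

  replaced-mono : Mono replaced
  replaced-mono C⊑D = +-mono-≤ (hits-mono copies C⊑D) (gadgetCount-mono C⊑D)

  -- Passing to the set given by `close` does not raise the gadget predimension, and there `h` and
  -- `h′` agree; meanwhile `Q` and `h` can only grow, which lowers the predimension further.
  Dom-closed : ∀ {Q h h′ : Sub N → ℕ} → Mono Q → Mono h → (∀ C → (∀ γ → Closed C γ) → h C ≡ h′ C) →
    Dom (λ C → Q C + (h C + gadgetCount C)) (λ C → Q C + (h′ C + gadgetCount C))
  Dom-closed {Q} {h} {h′} Q-mono h-mono agree C with close C
  ... | D , C⊑D , closed , δ = D , C⊑D , ≤-by (+-mono-≤ δ (+-mono-≤ (Q-mono C⊑D) (≤-trans (h-mono C⊑D) (≤-reflexive (agree D closed)))))
    (≤-reflexive (ring (size D) (Q C) (h C) (gadgetCount C) (size C) (gadgetCount D) (Q D) (h′ D)))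
    where
    ring : ∀ d qc hc gc c gd qd hd → d + (qc + (hc + gc)) + (c + gd + (qd + hd)) ≡ c + (qd + (hd + gd)) + (d + gc + (qc + hc))
    ring = solve-∀

  original⇒replaced : ∀ {Q} → Mono Q → Dom (λ C → Q C + original C) (λ C → Q C + replaced C)
  original⇒replaced Q-mono = Dom-closed Q-mono (λ C⊑D → hits-mono fs (λ v → C⊑D (old v))) (λ C closed → ≡-sym (hits-copies C closed))

  replaced⇒original : ∀ {Q} → Mono Q → Dom (λ C → Q C + replaced C) (λ C → Q C + original C)
  replaced⇒original Q-mono = Dom-closed Q-mono (hits-mono copies) hits-copies

  -- Self-sufficiency of the base is moved from the original facts to the copies: for a superset `D`
  -- whose predimension with the original facts is no larger, `bound` controls the old part and
  -- `gadgetCount≤` the rest. `Q` is zero because the facts inside the base have been cancelled.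
  replaced-bound : ∀ {k} C → (∀ D → C ⊑ D → k + hits (D ∘ old) fs ≤ size (D ∘ old)) → k + replaced C ≤ size C
  replaced-bound {k} C bound =
    let D , C⊑D , δ = replaced⇒original {λ _ → 0} (λ _ → z≤n) C in
    ≤-by (+-mono-≤ δ (+-mono-≤ (bound D C⊑D) (gadgetCount≤ D)))
      (≤-reflexive (ring k (replaced C) (size C) (hits (D ∘ old) fs) (gadgetCount D) (size (D ∘ old)) (size D)))
    where
    ring : ∀ k rc c h g so d → k + rc + (c + (h + g) + (so + d)) ≡ c + (d + rc + (k + h + (so + g)))
    ring = solve-∀

-- Isomorphisms of geometries

-- `Dom` for whole structures along a map. Finite sets suffice, since d is a minimum over finite
-- supersets.
Dominates : (L : Lang) (μ : Mode) {X : Set} (S : Str L X) (ν : Mode) {Y : Set} (T : Str L Y) → (X → Y) → Set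
Dominates L μ {X} S ν {Y} T F = ∀ C → Unique C → ∀ m → FactCount L μ S C m →
  Σ (List Y) λ D → Unique D × (∀ x → x ∈ C → F x ∈ D) ×
  Σ ℕ λ m′ → FactCount L ν T D m′ × length D + m ≤ length C + m′

module _ (L : Lang) {μ ν : Mode} {X Y : Set} {S : Str L X} {T : Str L Y}
  (F : X → Y) (H : Y → X) (FH : ∀ y → F (H y) ≡ y)
  (F-dominates : Dominates L μ S ν T F) (H-dominates : Dominates L ν T μ S H) where

  -- Dominating an optimal set for `P` yields a set containing `Q` of predimension at most `k`. No
  -- set containing `Q` does better, because it is dominated in turn by a set containing `P`, to
  -- which `minimal` applies.
  DIs-transport : ∀ {P : X → Set} {Q : Y → Set} → (∀ y → Q y → P (H y)) → (∀ x → P x → Q (F x)) →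
    (∀ x → H (F x) ≡ x) → ∀ {k} → DIs L μ S P k → DIs L ν T Q k
  DIs-transport {P} {Q} Q⇒P P⇒Q HF {k} ((A , A! , P⊆A , m , c , len) , minimal)
    with F-dominates A A! m c
  ... | D , D! , FA⊆D , m′ , c′ , δ = (D , D! , Q⊆D , m′ , c′ , ≤-antisym upper (lower D D! Q⊆D m′ c′)) , lower
    where
    Q⊆D : ∀ y → Q y → y ∈ D
    Q⊆D y q = subst (_∈ D) (FH y) (FA⊆D (H y) (P⊆A (H y) (Q⇒P y q)))
    lower : ∀ B → Unique B → (∀ y → Q y → y ∈ B) → δ≥ L ν T B k
    lower B B! Q⊆B l cB with H-dominates B B! l cB
    ... | E , E! , HB⊆E , l′ , cE , δ′ =
      ≤-by (+-mono-≤ δ′ (minimal E E! (λ x p → subst (_∈ E) (HF x) (HB⊆E (F x) (Q⊆B (F x) (P⇒Q x p)))) l′ cE))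
           (≤-reflexive (ring k l (length B) l′ (length E)))
      where
      ring : ∀ k l b l′ e → k + l + (b + l′ + e) ≡ b + (e + l + (k + l′))
      ring = solve-∀
    upper : length D ≤ k + m′
    upper = ≤-by δ (≤-reflexive (trans (cong (λ a → length D + (a + m′)) len) (ring (length D) k m m′)))
      where
      ring : ∀ d k m m′ → d + (k + m + m′) ≡ k + m′ + (d + m)
      ring = solve-∀

  clFin-transport : (∀ x → H (F x) ≡ x) → ∀ {A B c} → (∀ x → x ∈ A ⟺ F x ∈ B) → clFin L μ S A c → clFin L ν T B (F c)
  clFin-transport HF {A} {B} {c} A⟺B (k , d , d′) = k ,
    DIs-transport (λ y y∈ → pull y y∈) (λ x → proj₁ (A⟺B x)) HF d ,
    DIs-transport
      (λ { y (inj₁ y∈) → inj₁ (pull y y∈) ; y (inj₂ refl) → inj₂ (HF c) })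
      (λ { x (inj₁ x∈) → inj₁ (proj₁ (A⟺B x) x∈) ; x (inj₂ refl) → inj₂ refl }) HF d′
    where
    pull : ∀ y → y ∈ B → H y ∈ A
    pull y y∈ = proj₂ (A⟺B (H y)) (subst (_∈ B) (≡-sym (FH y)) y∈)

-- A bijection F whose two directions dominate preserves d, hence the closure operators.
module Geometry (L : Lang) {μ ν : Mode} {X Y : Set} {S : Str L X} {T : Str L Y}
  (F : X → Y) (H : Y → X) (FH : ∀ y → F (H y) ≡ y) (HF : ∀ x → H (F x) ≡ x)
  (F-dominates : Dominates L μ S ν T F) (H-dominates : Dominates L ν T μ S H) where

  clFin⁺ : ∀ {A B c} → (∀ x → x ∈ A ⟺ F x ∈ B) → clFin L μ S A c → clFin L ν T B (F c)
  clFin⁺ = clFin-transport L F H FH F-dominates H-dominates HF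

  clFin⁻ : ∀ {A B c} → (∀ x → x ∈ A ⟺ F x ∈ B) → clFin L ν T B (F c) → clFin L μ S A c
  clFin⁻ {A} {B} {c} A⟺B h = subst (clFin L μ S A) (HF c)
    (clFin-transport L H F HF H-dominates F-dominates FH (λ y →
      (λ y∈ → proj₂ (A⟺B (H y)) (subst (_∈ B) (≡-sym (FH y)) y∈)) ,
      (λ Hy∈ → subst (_∈ B) (FH y) (proj₁ (A⟺B (H y)) Hy∈))) h)

  F-inj : ∀ {x x′} → F x ≡ F x′ → x ≡ x′
  F-inj {x} {x′} e = trans (≡-sym (HF x)) (trans (cong H e) (HF x′))

  []-⟺ : ∀ (x : X) → x ∈ [] ⟺ F x ∈ []
  []-⟺ x = (λ ()) , (λ ())

  [_]-⟺ : ∀ x₀ x → x ∈ List.[ x₀ ] ⟺ F x ∈ List.[ F x₀ ]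
  [ x₀ ]-⟺ x = (λ { (here refl) → here refl }) , (λ { (here e) → here (F-inj e) })

  f : Point L μ S → Point L ν T
  f (x , loop) = F x , λ c → loop (clFin⁻ []-⟺ c)

  g : Point L ν T → Point L μ S
  g (y , loop) = H y , λ c → loop (subst (clFin L ν T []) (FH y) (clFin⁺ []-⟺ c))

  ptSet-f : ∀ p z → ptSet L μ S p z ⟺ ptSet L ν T (f p) (F z)
  ptSet-f (x , _) z =
    (λ (c , l) → clFin⁺ [ x ]-⟺ c , λ c′ → l (clFin⁻ []-⟺ c′)) ,
    (λ (c , l) → clFin⁻ [ x ]-⟺ c , λ c′ → l (clFin⁺ []-⟺ c′))

  PtEq-reflect : ∀ {p p′} → (∀ z → ptSet L ν T p (F z) ⟺ ptSet L ν T p′ (F z)) → PtEq L ν T p p′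
  PtEq-reflect {p} {p′} h w = subst (λ w → ptSet L ν T p w ⟺ ptSet L ν T p′ w) (FH w) (h (H w))

  ptSet-base : ∀ ρ {Z} (U : Str L Z) (p q : Point L ρ U) → proj₁ p ≡ proj₁ q → PtEq L ρ U p q
  ptSet-base ρ U (x , _) (.x , _) refl z = id , id

  f-cong : ∀ p p′ → PtEq L μ S p p′ → PtEq L ν T (f p) (f p′)
  f-cong p p′ h = PtEq-reflect {f p} {f p′} (λ z →
    (λ m → proj₁ (ptSet-f p′ z) (proj₁ (h z) (proj₂ (ptSet-f p z) m))) ,
    (λ m → proj₁ (ptSet-f p z) (proj₂ (h z) (proj₂ (ptSet-f p′ z) m))))

  fg : ∀ q → PtEq L ν T (f (g q)) q
  fg q = ptSet-base ν T (f (g q)) q (FH (proj₁ q))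

  gf : ∀ p → PtEq L μ S (g (f p)) p
  gf p = ptSet-base μ S (g (f p)) p (HF (proj₁ p))

  g-cong : ∀ q q′ → PtEq L ν T q q′ → PtEq L μ S (g q) (g q′)
  g-cong q q′ h z =
    (λ m → proj₂ (ptSet-f (g q′) z) (proj₂ (fg q′ (F z)) (proj₁ (h (F z)) (proj₁ (fg q (F z)) (proj₁ (ptSet-f (g q) z) m))))) ,
    (λ m → proj₂ (ptSet-f (g q) z) (proj₂ (fg q (F z)) (proj₂ (h (F z)) (proj₁ (fg q′ (F z)) (proj₁ (ptSet-f (g q′) z) m)))))

  map-⟺ : ∀ A x → x ∈ A ⟺ F x ∈ List.map F A
  map-⟺ A x = ∈P.∈-map⁺ F , back
    where
    back : F x ∈ List.map F A → x ∈ A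
    back Fx∈ with ∈P.∈-map⁻ F Fx∈
    ... | y , y∈ , e = subst (_∈ A) (≡-sym (F-inj e)) y∈

  cl⁺ : ∀ {P Q} → (∀ x → P x → Q (F x)) → ∀ {c} → cl L μ S P c → cl L ν T Q (F c)
  cl⁺ {P} {Q} PQ (A , A⊆P , c) = List.map F A , sub , clFin⁺ (map-⟺ A) c
    where
    sub : ∀ y → y ∈ List.map F A → Q y
    sub y y∈ with ∈P.∈-map⁻ F y∈
    ... | x , x∈ , refl = PQ x (A⊆P x x∈)

  cl⁻ : ∀ {P Q} → (∀ x → Q (F x) → P x) → ∀ {c} → cl L ν T Q (F c) → cl L μ S P c
  cl⁻ {P} {Q} QP (B , B⊆Q , c) = List.map H B , sub , clFin⁻ same c
    where
    sub : ∀ x → x ∈ List.map H B → P x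
    sub x x∈ with ∈P.∈-map⁻ H x∈
    ... | y , y∈ , refl = QP (H y) (subst Q (≡-sym (FH y)) (B⊆Q y y∈))
    same : ∀ x → x ∈ List.map H B ⟺ F x ∈ B
    same x = to , (λ Fx∈ → subst (_∈ List.map H B) (HF x) (∈P.∈-map⁺ H Fx∈))
      where
      to : x ∈ List.map H B → F x ∈ B
      to x∈ with ∈P.∈-map⁻ H x∈
      ... | y , y∈ , refl = subst (_∈ B) (≡-sym (FH y)) y∈

  module _ (Q : Point L μ S → Set) where
    fQ : Point L ν T → Set
    fQ q = Σ (Point L μ S) λ p′ → Q p′ × PtEq L ν T (f p′) q

    forward : ∀ w → (Σ (Point L μ S) λ q → Q q × ptSet L μ S q w) → Σ (Point L ν T) λ q → fQ q × ptSet L ν T q (F w)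
    forward w (q , Qq , m) = f q , (q , Qq , λ z → id , id) , proj₁ (ptSet-f q w) m

    backward : ∀ w → (Σ (Point L ν T) λ q → fQ q × ptSet L ν T q (F w)) → Σ (Point L μ S) λ q → Q q × ptSet L μ S q w
    backward w (q , (p , Qp , eq) , m) = p , Qp , proj₂ (ptSet-f p w) (proj₂ (eq (F w)) m)

    clG-⟺ : ∀ p → clG L μ S Q p ⟺ clG L ν T fQ (f p)
    clG-⟺ p = to , from
      where
      to : clG L μ S Q p → clG L ν T fQ (f p)
      to h w m = subst (cl L ν T _) (FH w)
        (cl⁺ forward (h (H w) (proj₂ (ptSet-f p (H w)) (subst (ptSet L ν T (f p)) (≡-sym (FH w)) m))))
      from : clG L ν T fQ (f p) → clG L μ S Q p
      from h z m = cl⁻ backward (h (F z) (proj₁ (ptSet-f p z) m))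

  geomIso : GeomIso L μ S ν T
  geomIso = f , g , f-cong , g-cong , gf , fg , clG-⟺

-- The back-and-forth argument

module BackAndForth (L : Lang) {X Y : Set} {M : Str L X} {M̂ : Str L Y} (G : IsGeneric L sym M) (Ĝ : IsGeneric L gen M̂) where
  open Lang L
  open Counting L
  open Classes L
  module A = Generic L sym {M = M} G
  module B = Generic L gen {M = M̂} Ĝ

  -- The finite bijection is given by a common index set, `a p` corresponding to `b p`. Both counts
  -- are then functions on the same subsets, as `Dom` requires.
  record State : Set where
    field
      {k} : ℕ
      a : Fin k → X
      b : Fin k → Y
      a-inj : Inj a
      b-inj : Inj b
      a-ss : A.SS a
      b-ss : B.SS b
      a⇒b : Dom (A.edges a-inj) (B.edges b-inj)
      b⇒a : Dom (B.edges b-inj) (A.edges a-inj)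
  open State

  infix 4 _⟶_
  record _⟶_ (s t : State) : Set where
    field
      ι : Fin (k s) → Fin (k t)
      a-ι : ∀ p → a t (ι p) ≡ a s p
      b-ι : ∀ p → b t (ι p) ≡ b s p
  open _⟶_

  ⟶-refl : ∀ {s} → s ⟶ s
  ⟶-refl = record { ι = id ; a-ι = λ _ → refl ; b-ι = λ _ → refl }

  ⟶-trans : ∀ {s t u} → s ⟶ t → t ⟶ u → s ⟶ u
  ⟶-trans f g = record
    { ι = ι g ∘ ι f
    ; a-ι = λ p → trans (a-ι g (ι f p)) (a-ι f p)
    ; b-ι = λ p → trans (b-ι g (ι f p)) (b-ι f p) }

  CoversA CoversB : State → ℕ → Set
  CoversA s j = ∀ x → x ∈ A.chain j → Image (a s) x
  CoversB s j = ∀ y → y ∈ B.chain j → Image (b s) y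

  empty : State
  empty = record
    { a = noX ; b = noY ; a-inj = λ () ; b-inj = λ () ; a-ss = A.empty-SS {noX} ; b-ss = B.empty-SS {noY}
    ; a⇒b = λ C → C , (λ _ e → e) , +-monoʳ-≤ (size C) (≤-trans (A.edges≤size {0} {noX} (λ ()) C) z≤n)
    ; b⇒a = λ C → C , (λ _ e → e) , +-monoʳ-≤ (size C) (≤-trans (B.edges≤size {0} {noY} (λ ()) C) z≤n) }
    where
    noX : Fin 0 → X
    noX ()
    noY : Fin 0 → Y
    noY ()

  abstract
    -- `new` holds one tuple for each unordered fact. Tuples with different sets of entries are
    -- different tuples, so the same list, read as facts of Ĉ₀(L), has the same count on every set.
    forth : ∀ s j → Σ State λ t → s ⟶ t × CoversA t j
    forth s j = record
      { a = OA.b ; b = OB.b ; a-inj = OA.b-inj ; b-inj = OB.b-inj ; a-ss = OA.b-ss ; b-ss = OB.b-ss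
      ; a⇒b = Dom-cong (≡-sym ∘ OA.b-edges) (≡-sym ∘ OB.b-edges) old⇒new
      ; b⇒a = Dom-cong (≡-sym ∘ OB.b-edges) (≡-sym ∘ OA.b-edges) new⇒old } ,
      record { ι = E.ι ; a-ι = OA.b-ι ; b-ι = OB.b-ι } , E.covers
      where
      module E = A.Enlargement (A.enlarge (a-inj s) (a-ss s) j)
      module OA = A.Over E.over
      old⇒new : Dom (λ C → A.edges (a-inj s) (C ∘ E.ι) + hits C E.new) (λ C → B.edges (b-inj s) (C ∘ E.ι) + hits C E.new)
      old⇒new = Dom-extend E.ι (a⇒b s) (B.edges-mono (b-inj s)) (hits-mono E.new)
      new⇒old : Dom (λ C → B.edges (b-inj s) (C ∘ E.ι) + hits C E.new) (λ C → A.edges (a-inj s) (C ∘ E.ι) + hits C E.new)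
      new⇒old = Dom-extend E.ι (b⇒a s) (A.edges-mono (a-inj s)) (hits-mono E.new)
      overB : B.Over (b-inj s) E.ι E.new
      overB = B.realise (b-inj s) (b-ss s) E.ι-inj E.new
        (AllPairs.map (λ n e → n (Same⇒sym gen e)) E.distinct) E.outside (All.tabulate (λ _ → tt))
        -- The class condition for the planned extension: it is dominated by the enlargement `OA.b`,
        -- which lies in `M` and satisfies the condition.
        (Dom-bounded new⇒old (λ C → subst (_≤ size C) (OA.b-edges C) (A.edges≤size OA.b-inj C)))
        E.self-sufficient
      module OB = B.Over overB

  -- In `M̂` the gadgets are hung on an enlargement that is already there. In `M` all points are
  -- added over `s` in a single extension, because there the facts of the enlargement exist only as
  -- copies on gadget points.
  module Back (s : State) (j : ℕ) where
    module E = B.Enlargement (B.enlarge (b-inj s) (b-ss s) j)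
    module OE = B.Over E.over
    module P = ParallelCopies L E.new
    open ≤-Reasoning

    overB : B.Over OE.b-inj P.old P.gadgets
    overB = B.realise OE.b-inj OE.b-ss P.old-inj P.gadgets
      (AllPairs.map (λ n e → n (Same⇒sym gen e)) P.gadgets-distinct) P.gadgets-outside (All.tabulate (λ _ → tt))
      (λ C → begin
        B.edges OE.b-inj (C ∘ P.old) + hits C P.gadgets ≤⟨ +-mono-≤ (B.edges≤size OE.b-inj (C ∘ P.old)) (≤-reflexive (P.hits-gadgets C)) ⟩
        size (C ∘ P.old) + P.gadgetCount C              ≤⟨ P.gadgetCount≤ C ⟩
        size C                                          ∎)
      (λ C full → begin
        E.n + hits C P.gadgets             ≡⟨ cong₂ _+_ (≡-sym (size-full full)) (P.hits-gadgets C) ⟩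
        size (C ∘ P.old) + P.gadgetCount C ≤⟨ P.gadgetCount≤ C ⟩
        size C                             ∎)
    module OB = B.Over overB

    ea eb : Sub P.N → ℕ
    ea C = A.edges (a-inj s) (C ∘ P.old ∘ E.ι)
    eb C = B.edges (b-inj s) (C ∘ P.old ∘ E.ι)
    ea-mono : Mono ea
    ea-mono C⊑D = A.edges-mono (a-inj s) (λ v → C⊑D (P.old (E.ι v)))
    eb-mono : Mono eb
    eb-mono C⊑D = B.edges-mono (b-inj s) (λ v → C⊑D (P.old (E.ι v)))

    b-edges : ∀ C → B.edges OB.b-inj C ≡ eb C + P.original C
    b-edges C = trans (OB.b-edges C) (trans (cong₂ _+_ (OE.b-edges (C ∘ P.old)) (P.hits-gadgets C)) (+-assoc (eb C) _ _))

    replaced≡ : ∀ C → hits C (P.copies List.++ P.gadgets) ≡ P.replaced C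
    replaced≡ C = trans (hits-++ C P.copies P.gadgets) (cong (hits C P.copies +_) (P.hits-gadgets C))

    -- The intermediate count takes the base from `M` and the remaining facts from `M̂`. It is used
    -- as a bare function on subsets, since facts with repeated entries have no place in C₀(L).
    gen⇒sym : Dom (λ C → eb C + P.original C) (λ C → ea C + P.replaced C)
    gen⇒sym = Dom-trans {g = λ C → ea C + P.original C}
      (Dom-extend (P.old ∘ E.ι) (b⇒a s) (A.edges-mono (a-inj s)) P.original-mono) (P.original⇒replaced ea-mono)

    sym⇒gen : Dom (λ C → ea C + P.replaced C) (λ C → eb C + P.original C)
    sym⇒gen = Dom-trans {g = λ C → eb C + P.replaced C}
      (Dom-extend (P.old ∘ E.ι) (a⇒b s) (B.edges-mono (b-inj s)) P.replaced-mono) (P.replaced⇒original eb-mono)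

    self-sufficient : ∀ C → (∀ p → C (P.old (E.ι p)) ≡ true) → k s + hits C (P.copies List.++ P.gadgets) ≤ size C
    self-sufficient C C⊇ = subst (λ h → k s + h ≤ size C) (≡-sym (replaced≡ C))
      (P.replaced-bound C (λ D C⊑D → E.self-sufficient (D ∘ P.old) (λ p → C⊑D (P.old (E.ι p)) (C⊇ p))))

    overA : A.Over (a-inj s) (P.old ∘ E.ι) (P.copies List.++ P.gadgets)
    overA = A.realise (a-inj s) (a-ss s) (λ p q e → E.ι-inj p q (P.old-inj _ _ e)) (P.copies List.++ P.gadgets)
      P.all-distinct
      (AllP.++⁺ (All.map weaken P.copies-outside) (All.map weaken P.gadgets-outside))
      P.all-good
      (λ C → subst (λ h → ea C + h ≤ size C) (≡-sym (replaced≡ C))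
        (Dom-bounded sym⇒gen (λ C → subst (_≤ size C) (b-edges C) (B.edges≤size OB.b-inj C)) C))
      self-sufficient
      where
      weaken : ∀ {κ} → ¬ Within (Image P.old) κ → ¬ Within (Image (P.old ∘ E.ι)) κ
      weaken out w = out (λ x x∈ → let p , e = w x x∈ in E.ι p , e)
    module OA = A.Over overA

    a-edges : ∀ C → A.edges OA.b-inj C ≡ ea C + P.replaced C
    a-edges C = trans (OA.b-edges C) (cong (ea C +_) (replaced≡ C))

    abstract
      result : Σ State λ t → s ⟶ t × CoversB t j
      result = record
        { a = OA.b ; b = OB.b ; a-inj = OA.b-inj ; b-inj = OB.b-inj ; a-ss = OA.b-ss ; b-ss = OB.b-ss
        ; a⇒b = Dom-cong (≡-sym ∘ a-edges) (≡-sym ∘ b-edges) sym⇒gen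
        ; b⇒a = Dom-cong (≡-sym ∘ b-edges) (≡-sym ∘ a-edges) gen⇒sym } ,
        record { ι = P.old ∘ E.ι ; a-ι = OA.b-ι ; b-ι = λ p → trans (OB.b-ι (E.ι p)) (OE.b-ι p) } ,
        λ y y∈ → let p , e = E.covers y y∈ in P.old p , trans (OB.b-ι p) e

  abstract
    next : ∀ s j → Σ State λ t → s ⟶ t × CoversA t j × CoversB t j
    next s j =
      let t , s⟶t , cA = forth s j
          u , t⟶u , cB = Back.result t j
      in u , ⟶-trans s⟶t t⟶u , (λ x x∈ → let p , e = cA x x∈ in ι t⟶u p , trans (a-ι t⟶u p) e) , cB

  -- The limit of the stages

  stage : ℕ → State
  stage zero = empty
  stage (suc j) = proj₁ (next (stage j) j)

  stage-mono : ∀ {i j} → i ≤ j → stage i ⟶ stage j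
  stage-mono i≤j = go (≤⇒≤′ i≤j)
    where
    go : ∀ {i j} → i ≤′ j → stage i ⟶ stage j
    go ≤′-refl = ⟶-refl
    go {j = suc j} (≤′-step p) = ⟶-trans (go p) (proj₁ (proj₂ (next (stage j) j)))

  stage-A : ∀ j → CoversA (stage (suc j)) j
  stage-A j = proj₁ (proj₂ (proj₂ (next (stage j) j)))

  stage-B : ∀ j → CoversB (stage (suc j)) j
  stage-B j = proj₂ (proj₂ (proj₂ (next (stage j) j)))

  Matched : ℕ → X → Y → Set
  Matched i x y = ∃ λ p → a (stage i) p ≡ x × b (stage i) p ≡ y

  Matched-mono : ∀ {i j} → i ≤ j → ∀ {x y} → Matched i x y → Matched j x y
  Matched-mono i≤j (p , ax , by) = ι f p , trans (a-ι f p) ax , trans (b-ι f p) by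
    where f = stage-mono i≤j

  Paired : X → Y → Set
  Paired x y = ∃ λ i → Matched i x y

  -- Two pairs found at different stages are moved to a common later one, where injectivity of its
  -- enumeration identifies their indices.
  Paired-functional : ∀ {x y y′} → Paired x y → Paired x y′ → y ≡ y′
  Paired-functional (i , m) (j , m′) with Matched-mono (m≤m⊔n i j) m | Matched-mono (m≤n⊔m i j) m′
  ... | p , refl , refl | q , e , refl = cong (b (stage (i ⊔ j))) (≡-sym (a-inj (stage (i ⊔ j)) q p e))

  Paired-injective : ∀ {x x′ y} → Paired x y → Paired x′ y → x ≡ x′
  Paired-injective (i , m) (j , m′) with Matched-mono (m≤m⊔n i j) m | Matched-mono (m≤n⊔m i j) m′
  ... | p , refl , refl | q , refl , e = cong (a (stage (i ⊔ j))) (≡-sym (b-inj (stage (i ⊔ j)) q p e))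

  to : ∀ x → Σ Y (Paired x)
  to x with A.chain-exhausts x
  ... | j , x∈ with stage-A j x x∈
  ... | p , e = b (stage (suc j)) p , suc j , p , e , refl

  from : ∀ y → Σ X λ x → Paired x y
  from y with B.chain-exhausts y
  ... | j , y∈ with stage-B j y y∈
  ... | p , e = a (stage (suc j)) p , suc j , p , refl , e

  F : X → Y
  F x = proj₁ (to x)

  H : Y → X
  H y = proj₁ (from y)

  HF : ∀ x → H (F x) ≡ x
  HF x = Paired-injective (proj₂ (from (F x))) (proj₂ (to x))

  FH : ∀ y → F (H y) ≡ y
  FH y = Paired-functional (proj₂ (to (H y))) (proj₂ (from y))

  -- All of `C` is covered by a single stage, and the set that this stage provides for the trace of
  -- `C` is already the one required in `M̂`.
  F-dominates : Dominates L sym M gen M̂ F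
  F-dominates C C! m c with A.chain-bound 0 (List.lookup C)
  ... | j , _ , all = elems (b s) D , elems-unique (b-inj s) D , mapped , B.edges (b-inj s) D , B.edges-FactCount (b-inj s) D ,
    subst₂ (λ d m → d + m ≤ length C + B.edges (b-inj s) D) (≡-sym (length-elems (b s) D)) (FactCount-unique L (A.traceCount (a-inj s) tC C⊆) c)
      (subst (λ c → size D + A.edges (a-inj s) (Trace.trace tC) ≤ c + B.edges (b-inj s) D) (Trace.trace-size tC C!) (proj₂ (proj₂ (a⇒b s (Trace.trace tC)))))
    where
    s : State
    s = stage (suc j)
    C⊆ : ∀ x → x ∈ C → Image (a s) x
    C⊆ x x∈ with A.∈⇒lookup x∈
    ... | p , refl = stage-A j _ (all p)
    tC : Trace (a s) C
    tC = traceOf (a-inj s) C C⊆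
    D : Sub _
    D = proj₁ (a⇒b s (Trace.trace tC))
    mapped : ∀ x → x ∈ C → F x ∈ elems (b s) D
    mapped x x∈ with C⊆ x x∈
    ... | p , refl = subst (_∈ elems (b s) D) (Paired-functional (suc j , p , refl , refl) (proj₂ (to (a s p))))
      (∈-elems⁺ (b s) D p (proj₁ (proj₂ (a⇒b s (Trace.trace tC))) p (proj₂ (Trace.trace-∈ tC p) x∈)))

  H-dominates : Dominates L gen M̂ sym M H
  H-dominates C C! m c with B.chain-bound 0 (List.lookup C)
  ... | j , _ , all = elems (a s) D , elems-unique (a-inj s) D , mapped , A.edges (a-inj s) D , A.edges-FactCount (a-inj s) D ,
    subst₂ (λ d m → d + m ≤ length C + A.edges (a-inj s) D) (≡-sym (length-elems (a s) D)) (FactCount-unique L (B.traceCount (b-inj s) tC C⊆) c)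
      (subst (λ c → size D + B.edges (b-inj s) (Trace.trace tC) ≤ c + A.edges (a-inj s) D) (Trace.trace-size tC C!) (proj₂ (proj₂ (b⇒a s (Trace.trace tC)))))
    where
    s : State
    s = stage (suc j)
    C⊆ : ∀ y → y ∈ C → Image (b s) y
    C⊆ y y∈ with B.∈⇒lookup y∈
    ... | p , refl = stage-B j _ (all p)
    tC : Trace (b s) C
    tC = traceOf (b-inj s) C C⊆
    D : Sub _
    D = proj₁ (b⇒a s (Trace.trace tC))
    mapped : ∀ y → y ∈ C → H y ∈ elems (a s) D
    mapped y y∈ with C⊆ y y∈
    ... | p , refl = subst (_∈ elems (a s) D) (Paired-injective (suc j , p , refl , refl) (proj₂ (from (b s p))))
      (∈-elems⁺ (a s) D p (proj₁ (proj₂ (b⇒a s (Trace.trace tC))) p (proj₂ (Trace.trace-∈ tC p) y∈)))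

theorem4p7 : (L : Lang) {X : Set} (M : Str L X) {Y : Set} (M̂ : Str L Y) →
    IsGeneric L sym M → IsGeneric L gen M̂ → GeomIso L sym M gen M̂
theorem4p7 L M M̂ G Ĝ = Geometry.geomIso L F H FH HF F-dominates H-dominates
  where open BackAndForth L {M = M} {M̂ = M̂} G Ĝ
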